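{- Let $G=(V,E,W)$ be a connected graph and $i,j\in V$ fixed distinct nodes. Then the map $\sigma\mapsto r^\sigma_{ij}$, defined on the set of $d$-dimensional signatures on $G$, is continuous.
   Context: $G$ finite connected weighted graph, $V=\{1,\dots,n\}$, $w_{xy}>0$ iff $\{x,y\}\in E$, $\deg(x)=\sum_yw_{xy}$. A $d$-dimensional signature is a map from oriented edges to $\mathsf{O}(d)$ with $\sigma_{yx}=\sigma_{xy}^{\mathrm T}$; the set of signatures is identified with $\mathsf{O}(d)^{E}$ (one matrix per edge with a fixed orientation) with the product topology. Connection Laplacian $\mathcal{L}^\sigma$: $nd\times nd$ block matrix with blocks $\deg(x)I_d$ on the diagonal, $-w_{xy}\sigma_{xy}$ for $x\sim y$, $0$ otherwise; $\dagger$ = Moore–Penrose pseudoinverse. $\Omega^0_{ij}=\mathbb{E}[\prod_{\ell=1}^{T^0_j}\sigma_{X_{\ell-1}X_\ell}\mid X_0=i]$ for the simple random walk with transition probabilities $w_{xy}/\deg(x)$ and $T^0_j=\inf\{t\ge0:X_t=j\}$. $N_{ij}$: $nd\times d$ block column with $I_d$ at node $i$, $-(\Omega^0_{ij})^{\mathrm T}$ at node $j$, $0$ elsewhere; $\mathcal{W}_{i\to j}=(\mathcal{L}^\sigma)^\dagger N_{ij}$. Connection effective resistance: $r^\sigma_{ij}=\frac{1}{2d}\operatorname{Tr}\big(\mathcal{W}_{i\to j}^{\mathrm T}\mathcal{L}^\sigma\mathcal{W}_{i\to j}+\mathcal{W}_{j\to i}^{\mathrm T}\mathcal{L}^\sigma\mathcal{W}_{j\to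 i}\big)$. -}

module Defs where

open import Algebra.Bundles using (CommutativeRing)
open import Data.Bool.Base using (Bool; true; false; if_then_else_)
open import Data.Empty using (⊥-elim)
open import Data.Fin.Base using (Fin; zero; suc; toℕ; quotient; remainder)
import Data.Fin.Properties as Fin
open import Data.Nat.Base as ℕ using (ℕ; zero; suc)
import Data.Nat.Properties as ℕ
open import Data.Product.Base using (Σ; Σ-syntax; ∃; ∃-syntax; _×_; _,_; proj₁; proj₂)
open import Data.Sum.Base using (_⊎_; inj₁; inj₂)
open import Data.Vec.Base using (Vec; []; _∷_)
open import Function.Base using (_∘_)
open import Level using (0ℓ)
open import Relation.Binary.Bundles using (StrictTotalOrder)
open import Relation.Binary.Core using (Rel)
open import Relation.Binary.Construct.Closure.ReflexiveTransitive using (Star)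
open import Relation.Binary.Definitions using (tri<; tri≈; tri>)
open import Relation.Binary.PropositionalEquality.Core as ≡ using (_≡_; _≢_)
open import Relation.Binary.Structures using (IsStrictTotalOrder)
open import Relation.Nullary.Decidable.Core using (Dec; yes; no; does; _×-dec_; ¬?)
open import Relation.Nullary.Negation.Core using (¬_)

-- The axioms characterise ℝ up to isomorphism; everything below is done
-- over an arbitrary model.  The order is classical (trichotomous), and a
-- supremum is approximated by elements of the set, which classically is the
-- same as being the least upper bound.

record CompleteOrderedField : Set₁ where
  infix 4 _<_ _≤_

  field
    commutativeRing : CommutativeRing 0ℓ 0ℓ

  open CommutativeRing commutativeRing public
    hiding (zero) renaming (Carrier to ℝ)

  field
    _<_                : Rel ℝ 0ℓ
    isStrictTotalOrder : IsStrictTotalOrder _≈_ _<_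
    0<1                : 0# < 1#
    +-monoʳ-<          : ∀ x {y z} → y < z → x + y < x + z
    *-pos              : ∀ {x y} → 0# < x → 0# < y → 0# < x * y
    invertible         : ∀ x → ¬ x ≈ 0# → ∃[ y ] x * y ≈ 1#

  _≤_ : Rel ℝ 0ℓ
  x ≤ y = x < y ⊎ x ≈ y

  IsUpperBound : (ℝ → Set) → ℝ → Set
  IsUpperBound P b = ∀ x → P x → x ≤ b

  IsSupremum : (ℝ → Set) → ℝ → Set
  IsSupremum P s = IsUpperBound P s × (∀ y → y < s → ∃[ x ] P x × y < x)

  field
    supremum : (P : ℝ → Set) → ∃ P → ∃ (IsUpperBound P) → ∃ (IsSupremum P)

module Real (𝓡 : CompleteOrderedField) where

  open CompleteOrderedField 𝓡 public
  open import Algebra.Properties.Ring ring public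
    using (-‿distribˡ-*; -‿distribʳ-*; -‿+-comm; -0#≈0#)
    renaming (-‿involutive to neg-involutive)
  open import Algebra.Properties.Semiring.Sum semiring public
  open import Algebra.Properties.Semiring.Mult semiring public
    using () renaming (_×_ to _×ℝ_)

  strictTotalOrder : StrictTotalOrder 0ℓ 0ℓ 0ℓ
  strictTotalOrder = record { isStrictTotalOrder = isStrictTotalOrder }

  open IsStrictTotalOrder isStrictTotalOrder public
    using (compare; _≟_; _<?_; <-resp-≈; <-respˡ-≈; <-respʳ-≈)
    renaming (trans to <-trans; irrefl to <-irrefl)

  open import Relation.Binary.Reasoning.StrictPartialOrder
    (StrictTotalOrder.strictPartialOrder strictTotalOrder) public

  infix 8 _⁻¹
  infixl 7 _/_

  -- Totalised by 0⁻¹ = 0.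
  _⁻¹ : ℝ → ℝ
  x ⁻¹ with x ≟ 0#
  ... | yes _  = 0#
  ... | no x≉0 = proj₁ (invertible x x≉0)

  _/_ : ℝ → ℝ → ℝ
  x / y = x * y ⁻¹

  ∣_∣ : ℝ → ℝ
  ∣ x ∣ = if does (x <? 0#) then - x else x

  infix 4 _⟶_

  _⟶_ : (ℕ → ℝ) → ℝ → Set
  s ⟶ l = ∀ ε → 0# < ε → ∃[ N ] ∀ m → N ℕ.≤ m → ∣ s m - l ∣ < ε

  partialSum : (ℕ → ℝ) → ℕ → ℝ
  partialSum f N = ∑[ t < N ] f (toℕ t)

  HasSum : (ℕ → ℝ) → ℝ → Set
  HasSum f s = partialSum f ⟶ s

  Summable : (ℕ → ℝ) → Set
  Summable f = ∃ (HasSum f)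

  *-⁻¹ : ∀ {x} → ¬ x ≈ 0# → x * x ⁻¹ ≈ 1#
  *-⁻¹ {x} x≉0 with x ≟ 0#
  ... | yes x≈0 = ⊥-elim (x≉0 x≈0)
  ... | no x≉0′ = proj₂ (invertible x x≉0′)

  ≈⇒≤ : ∀ {x y} → x ≈ y → x ≤ y
  ≈⇒≤ = inj₂

  ≤-trans : ∀ {x y z} → x ≤ y → y ≤ z → x ≤ z
  ≤-trans {x} {y} {z} p q = begin x ≤⟨ p ⟩ y ≤⟨ q ⟩ z ∎

  ≤-<-trans : ∀ {x y z} → x ≤ y → y < z → x < z
  ≤-<-trans {x} {y} {z} p q = begin-strict x ≤⟨ p ⟩ y <⟨ q ⟩ z ∎

  <-≤-trans : ∀ {x y z} → x < y → y ≤ z → x < z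
  <-≤-trans {x} {y} {z} p q = begin-strict x <⟨ p ⟩ y ≤⟨ q ⟩ z ∎

  +-monoˡ-< : ∀ x {y z} → y < z → y + x < z + x
  +-monoˡ-< x {y} {z} y<z = begin-strict
    y + x ≈⟨ +-comm y x ⟩
    x + y <⟨ +-monoʳ-< x y<z ⟩
    x + z ≈⟨ +-comm x z ⟩
    z + x ∎

  +-monoʳ-≤ : ∀ x {y z} → y ≤ z → x + y ≤ x + z
  +-monoʳ-≤ x (inj₁ y<z) = inj₁ (+-monoʳ-< x y<z)
  +-monoʳ-≤ x (inj₂ y≈z) = inj₂ (+-congˡ y≈z)

  +-monoˡ-≤ : ∀ x {y z} → y ≤ z → y + x ≤ z + x
  +-monoˡ-≤ x (inj₁ y<z) = inj₁ (+-monoˡ-< x y<z)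
  +-monoˡ-≤ x (inj₂ y≈z) = inj₂ (+-congʳ y≈z)

  +-mono-≤ : ∀ {x y u v} → x ≤ y → u ≤ v → x + u ≤ y + v
  +-mono-≤ {x} {y} {u} {v} p q = ≤-trans (+-monoˡ-≤ u p) (+-monoʳ-≤ y q)

  +-mono-< : ∀ {x y u v} → x < y → u < v → x + u < y + v
  +-mono-< {x} {y} {u} {v} p q = <-trans (+-monoˡ-< u p) (+-monoʳ-< y q)

  0≤+ : ∀ {x y} → 0# ≤ x → 0# ≤ y → 0# ≤ x + y
  0≤+ {x} {y} p q = begin
    0#      ≈⟨ +-identityʳ 0# ⟨
    0# + 0# ≤⟨ +-mono-≤ p q ⟩
    x + y   ∎

  ≤⇒0≤- : ∀ {x y} → x ≤ y → 0# ≤ y - x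
  ≤⇒0≤- {x} {y} p = begin
    0#    ≈⟨ -‿inverseʳ x ⟨
    x - x ≤⟨ +-monoˡ-≤ (- x) p ⟩
    y - x ∎

  +-cancel-neg : ∀ x y → (x - y) + y ≈ x
  +-cancel-neg x y = begin-equality
    (x - y) + y   ≈⟨ +-assoc x (- y) y ⟩
    x + (- y + y) ≈⟨ +-congˡ (-‿inverseˡ y) ⟩
    x + 0#        ≈⟨ +-identityʳ x ⟩
    x             ∎

  0≤-⇒≤ : ∀ {x y} → 0# ≤ y - x → x ≤ y
  0≤-⇒≤ {x} {y} p = begin
    x           ≈⟨ +-identityˡ x ⟨
    0# + x      ≤⟨ +-monoˡ-≤ x p ⟩
    (y - x) + x ≈⟨ +-cancel-neg y x ⟩
    y           ∎

  neg-anti-< : ∀ {x y} → x < y → - y < - x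
  neg-anti-< {x} {y} x<y = begin-strict
    - y             ≈⟨ +-identityˡ (- y) ⟨
    0# - y          ≈⟨ +-congʳ (-‿inverseʳ x) ⟨
    (x - x) - y     ≈⟨ +-assoc x (- x) (- y) ⟩
    x + (- x - y)   <⟨ +-monoˡ-< (- x - y) x<y ⟩
    y + (- x - y)   ≈⟨ +-congˡ (+-comm (- x) (- y)) ⟩
    y + (- y - x)   ≈⟨ +-assoc y (- y) (- x) ⟨
    (y - y) - x     ≈⟨ +-congʳ (-‿inverseʳ y) ⟩
    0# - x          ≈⟨ +-identityˡ (- x) ⟩
    - x             ∎

  x<0⇒0<-x : ∀ {x} → x < 0# → 0# < - x
  x<0⇒0<-x x<0 = <-respˡ-≈ -0#≈0# (neg-anti-< x<0)

  *-nonneg : ∀ {x y} → 0# ≤ x → 0# ≤ y → 0# ≤ x * y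
  *-nonneg (inj₁ p) (inj₁ q) = inj₁ (*-pos p q)
  *-nonneg {x} {y} (inj₂ p) q = inj₂ (sym (trans (*-congʳ (sym p)) (zeroˡ y)))
  *-nonneg {x} {y} (inj₁ p) (inj₂ q) = inj₂ (sym (trans (*-congˡ (sym q)) (zeroʳ x)))

  *-monoʳ-≤ : ∀ {x y z} → 0# ≤ x → y ≤ z → x * y ≤ x * z
  *-monoʳ-≤ {x} {y} {z} 0≤x y≤z = 0≤-⇒≤ (begin
    0#                ≤⟨ *-nonneg 0≤x (≤⇒0≤- y≤z) ⟩
    x * (z - y)       ≈⟨ distribˡ x z (- y) ⟩
    x * z + x * - y   ≈⟨ +-congˡ (-‿distribʳ-* x y) ⟨
    x * z - x * y     ∎)

  neg-sq : ∀ x → - x * - x ≈ x * x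
  neg-sq x = begin-equality
    - x * - x   ≈⟨ -‿distribˡ-* x (- x) ⟨
    - (x * - x) ≈⟨ -‿cong (-‿distribʳ-* x x) ⟨
    - - (x * x) ≈⟨ neg-involutive (x * x) ⟩
    x * x       ∎

  sq-pos : ∀ {x} → ¬ x ≈ 0# → 0# < x * x
  sq-pos {x} x≉0 with compare x 0#
  ... | tri< x<0 _ _ = <-respʳ-≈ (neg-sq x) (*-pos (x<0⇒0<-x x<0) (x<0⇒0<-x x<0))
  ... | tri≈ _ x≈0 _ = ⊥-elim (x≉0 x≈0)
  ... | tri> _ _ 0<x = *-pos 0<x 0<x

  sq-nonneg : ∀ x → 0# ≤ x * x
  sq-nonneg x with x ≟ 0#
  ... | yes x≈0 = inj₂ (sym (trans (*-congʳ x≈0) (zeroˡ x)))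
  ... | no x≉0  = inj₁ (sq-pos x≉0)

  sq≤1⇒≤1 : ∀ {x} → x * x ≤ 1# → x ≤ 1#
  sq≤1⇒≤1 {x} x²≤1 with compare x 1#
  ... | tri< x<1 _ _ = inj₁ x<1
  ... | tri≈ _ x≈1 _ = inj₂ x≈1
  ... | tri> _ _ 1<x = ⊥-elim (<-irrefl refl (begin-strict
    1#      <⟨ 1<x ⟩
    x       ≈⟨ *-identityʳ x ⟨
    x * 1#  ≤⟨ *-monoʳ-≤ (inj₁ (<-trans 0<1 1<x)) (inj₁ 1<x) ⟩
    x * x   ≤⟨ x²≤1 ⟩
    1#      ∎))

  pos⇒≉0 : ∀ {x} → 0# < x → ¬ x ≈ 0#
  pos⇒≉0 0<x x≈0 = <-irrefl (sym x≈0) 0<x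

  ⁻¹-pos : ∀ {x} → 0# < x → 0# < x ⁻¹
  ⁻¹-pos {x} 0<x with compare (x ⁻¹) 0#
  ... | tri> _ _ 0<y = 0<y
  ... | tri≈ _ y≈0 _ = ⊥-elim (<-irrefl refl (begin-strict
    0#         <⟨ 0<1 ⟩
    1#         ≈⟨ *-⁻¹ (pos⇒≉0 0<x) ⟨
    x * x ⁻¹   ≈⟨ *-congˡ y≈0 ⟩
    x * 0#     ≈⟨ zeroʳ x ⟩
    0#         ∎))
  ... | tri< y<0 _ _ = ⊥-elim (<-irrefl refl (begin-strict
    0#               <⟨ *-pos 0<x (x<0⇒0<-x y<0) ⟩
    x * - (x ⁻¹)     ≈⟨ -‿distribʳ-* x (x ⁻¹) ⟨
    - (x * x ⁻¹)     ≈⟨ -‿cong (*-⁻¹ (pos⇒≉0 0<x)) ⟩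
    - 1#             <⟨ neg-anti-< 0<1 ⟩
    - 0#             ≈⟨ -0#≈0# ⟩
    0#               ∎))

  ⁻¹-nonneg : ∀ {x} → 0# ≤ x → 0# ≤ x ⁻¹
  ⁻¹-nonneg (inj₁ 0<x) = inj₁ (⁻¹-pos 0<x)
  ⁻¹-nonneg {x} (inj₂ 0≈x) with x ≟ 0#
  ... | yes _  = inj₂ refl
  ... | no x≉0 = ⊥-elim (x≉0 (sym 0≈x))

  0<2 : 0# < 1# + 1#
  0<2 = begin-strict
    0#      ≈⟨ +-identityʳ 0# ⟨
    0# + 0# <⟨ +-mono-< 0<1 0<1 ⟩
    1# + 1# ∎

  half : ∀ ε → 0# < ε → ∃[ h ] 0# < h × h + h ≈ ε
  half ε 0<ε = h , *-pos 0<ε (⁻¹-pos 0<2) , (begin-equality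
    h + h                      ≈⟨ +-cong (*-identityʳ h) (*-identityʳ h) ⟨
    h * 1# + h * 1#            ≈⟨ distribˡ h 1# 1# ⟨
    h * (1# + 1#)              ≈⟨ *-assoc ε _ _ ⟩
    ε * (2⁻¹ * (1# + 1#))      ≈⟨ *-congˡ (*-comm _ _) ⟩
    ε * ((1# + 1#) * 2⁻¹)      ≈⟨ *-congˡ (*-⁻¹ (pos⇒≉0 0<2)) ⟩
    ε * 1#                     ≈⟨ *-identityʳ ε ⟩
    ε                          ∎)
    where
    2⁻¹ = (1# + 1#) ⁻¹
    h = ε * 2⁻¹

  ∣∣<-intro : ∀ {x ε} → x < ε → - x < ε → ∣ x ∣ < ε
  ∣∣<-intro {x} x<ε -x<ε with does (x <? 0#)
  ... | true  = -x<ε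
  ... | false = x<ε

  ∣∣<-elim : ∀ {x ε} → ∣ x ∣ < ε → x < ε × - x < ε
  ∣∣<-elim {x} {ε} h with x <? 0#
  ... | yes x<0 = <-trans x<0 (<-trans (x<0⇒0<-x x<0) h) , h
  ... | no x≮0 with compare x 0#
  ...   | tri< x<0 _ _ = ⊥-elim (x≮0 x<0)
  ...   | tri≈ _ x≈0 _ = h , <-respˡ-≈ (trans x≈0 (trans (sym -0#≈0#) (-‿cong (sym x≈0)))) h
  ...   | tri> _ _ 0<x = h , <-trans (<-respʳ-≈ -0#≈0# (neg-anti-< 0<x)) (<-trans 0<x h)

  sum-mono-≤ : ∀ {n} {f g : Fin n → ℝ} → (∀ i → f i ≤ g i) → sum f ≤ sum g
  sum-mono-≤ {zero}  p = ≈⇒≤ refl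
  sum-mono-≤ {suc n} p = +-mono-≤ (p zero) (sum-mono-≤ (p ∘ suc))

  sum-zero : ∀ {n} {f : Fin n → ℝ} → (∀ i → f i ≈ 0#) → sum f ≈ 0#
  sum-zero {n} p = trans (sum-cong-≋ p) (sum-replicate-zero n)

  sum-nonneg : ∀ {n} {f : Fin n → ℝ} → (∀ i → 0# ≤ f i) → 0# ≤ sum f
  sum-nonneg {zero}  p = ≈⇒≤ refl
  sum-nonneg {suc n} p = 0≤+ (p zero) (sum-nonneg (p ∘ suc))

  term≤sum : ∀ {n} {f : Fin n → ℝ} → (∀ i → 0# ≤ f i) → ∀ k → f k ≤ sum f
  term≤sum {suc n} {f} p zero = begin
    f zero                    ≈⟨ +-identityʳ _ ⟨
    f zero + 0#               ≤⟨ +-monoʳ-≤ _ (sum-nonneg (p ∘ suc)) ⟩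
    f zero + sum (f ∘ suc)    ∎
  term≤sum {suc n} {f} p (suc k) = begin
    f (suc k)                 ≤⟨ term≤sum (p ∘ suc) k ⟩
    sum (f ∘ suc)             ≈⟨ +-identityˡ _ ⟨
    0# + sum (f ∘ suc)        ≤⟨ +-monoˡ-≤ _ (p zero) ⟩
    f zero + sum (f ∘ suc)    ∎

  sum-sq-zero : ∀ {n} (f : Fin n → ℝ) → ∑[ i < n ] (f i * f i) ≈ 0# → ∀ k → f k ≈ 0#
  sum-sq-zero f p k with f k ≟ 0#
  ... | yes q = q
  ... | no q  = ⊥-elim (<-irrefl refl (begin-strict
    0#                        <⟨ sq-pos q ⟩
    f k * f k                 ≤⟨ term≤sum (λ i → sq-nonneg (f i)) k ⟩
    sum (λ i → f i * f i)     ≈⟨ p ⟩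
    0#                        ∎))

  partialSum-step : ∀ {f} → (∀ t → 0# ≤ f t) → ∀ N → partialSum f N ≤ partialSum f (suc N)
  partialSum-step {f} p zero    = 0≤+ (p 0) (≈⇒≤ refl)
  partialSum-step {f} p (suc N) = +-monoʳ-≤ (f 0) (partialSum-step {f ∘ suc} (p ∘ suc) N)

  partialSum-mono : ∀ {f} → (∀ t → 0# ≤ f t) → ∀ {M N} → M ℕ.≤′ N → partialSum f M ≤ partialSum f N
  partialSum-mono     p ℕ.≤′-refl               = ≈⇒≤ refl
  partialSum-mono {f} p (ℕ.≤′-step {n = N} M≤N) =
    ≤-trans (partialSum-mono {f} p M≤N) (partialSum-step {f} p N)

  nonneg-summable : ∀ {f} → (∀ t → 0# ≤ f t) → ∀ b → (∀ N → partialSum f N ≤ b) → Summable f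
  nonneg-summable {f} f≥0 b bounded = l , converges
    where
    s = partialSum f

    P : ℝ → Set
    P x = ∃[ N ] s N ≈ x

    sup = supremum P (s 0 , 0 , refl)
      (b , λ { x (N , sN≈x) → ≤-trans (≈⇒≤ (sym sN≈x)) (bounded N) })
    l = proj₁ sup

    upper : ∀ N → s N ≤ l
    upper N = proj₁ (proj₂ sup) (s N) (N , refl)

    converges : s ⟶ l
    converges ε 0<ε with proj₂ (proj₂ sup) (l - ε) l-ε<l
      where
      l-ε<l : l - ε < l
      l-ε<l = begin-strict
        l - ε   <⟨ +-monoʳ-< l (<-respʳ-≈ -0#≈0# (neg-anti-< 0<ε)) ⟩
        l + 0#  ≈⟨ +-identityʳ l ⟩
        l       ∎
    ... | x , (N , sN≈x) , l-ε<x = N , λ m N≤m → ∣∣<-intro (above m) (below m N≤m)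
      where
      above : ∀ m → s m - l < ε
      above m = begin-strict
        s m - l ≤⟨ +-monoˡ-≤ (- l) (upper m) ⟩
        l - l   ≈⟨ -‿inverseʳ l ⟩
        0#      <⟨ 0<ε ⟩
        ε       ∎

      below : ∀ m → N ℕ.≤ m → - (s m - l) < ε
      below m N≤m = begin-strict
        - (s m - l)         ≈⟨ -‿+-comm (s m) (- l) ⟨
        - s m - - l         ≈⟨ +-congˡ (neg-involutive l) ⟩
        - s m + l           ≈⟨ +-congˡ (+-cancel-neg l ε) ⟨
        - s m + ((l - ε) + ε)  <⟨ +-monoʳ-< (- s m) (+-monoˡ-< ε l-ε<sm) ⟩
        - s m + (s m + ε)   ≈⟨ +-assoc (- s m) (s m) ε ⟨
        (- s m + s m) + ε   ≈⟨ +-congʳ (-‿inverseˡ (s m)) ⟩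
        0# + ε              ≈⟨ +-identityˡ ε ⟩
        ε                   ∎
        where
        l-ε<sm : l - ε < s m
        l-ε<sm = begin-strict
          l - ε <⟨ l-ε<x ⟩
          x     ≈⟨ sN≈x ⟨
          s N   ≤⟨ partialSum-mono {f} f≥0 (ℕ.≤⇒≤′ N≤m) ⟩
          s m   ∎

  +-swap : ∀ a b c d → (a + b) + (c + d) ≈ (a + c) + (b + d)
  +-swap a b c d = begin-equality
    (a + b) + (c + d) ≈⟨ +-assoc a b _ ⟩
    a + (b + (c + d)) ≈⟨ +-congˡ (+-assoc b c d) ⟨
    a + ((b + c) + d) ≈⟨ +-congˡ (+-congʳ (+-comm b c)) ⟩
    a + ((c + b) + d) ≈⟨ +-congˡ (+-assoc c b d) ⟩
    a + (c + (b + d)) ≈⟨ +-assoc a c _ ⟨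
    (a + c) + (b + d) ∎

  ⟶-diff : ∀ {s t u l m} → (∀ N → s N ≈ u N + t N) → s ⟶ l → t ⟶ m → u ⟶ l - m
  ⟶-diff {s} {t} {u} {l} {m} s≈u+t s⟶l t⟶m ε 0<ε =
    let h , 0<h , h+h≈ε = half ε 0<ε
        M , sM = s⟶l h 0<h
        N , tN = t⟶m h 0<h
    in M ℕ.⊔ N , λ k M⊔N≤k →
       let a = ∣∣<-elim (sM k (ℕ.≤-trans (ℕ.m≤m⊔n M N) M⊔N≤k))
           b = ∣∣<-elim (tN k (ℕ.≤-trans (ℕ.m≤n⊔m M N) M⊔N≤k))
       in ∣∣<-intro
            (begin-strict
              u k - (l - m)                ≈⟨ split k ⟩
              (s k - l) + - (t k - m)      <⟨ +-mono-< (proj₁ a) (proj₂ b) ⟩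
              h + h                        ≈⟨ h+h≈ε ⟩
              ε                            ∎)
            (begin-strict
              - (u k - (l - m))                 ≈⟨ -‿cong (split k) ⟩
              - ((s k - l) + - (t k - m))       ≈⟨ -‿+-comm _ _ ⟨
              - (s k - l) + - - (t k - m)       ≈⟨ +-congˡ (neg-involutive _) ⟩
              - (s k - l) + (t k - m)           <⟨ +-mono-< (proj₂ a) (proj₁ b) ⟩
              h + h                             ≈⟨ h+h≈ε ⟩
              ε                                 ∎)
    where
    split : ∀ k → u k - (l - m) ≈ (s k - l) + - (t k - m)
    split k = begin-equality
      u k - (l - m)                          ≈⟨ +-identityʳ _ ⟨
      (u k - (l - m)) + 0#                   ≈⟨ +-congˡ (-‿inverseʳ (t k)) ⟨
      (u k - (l - m)) + (t k - t k)          ≈⟨ +-swap _ _ _ _ ⟩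
      (u k + t k) + (- (l - m) - t k)        ≈⟨ +-cong (s≈u+t k) (+-congʳ (-‿+-comm l (- m))) ⟨
      s k + ((- l - - m) - t k)              ≈⟨ +-congˡ (+-assoc (- l) (- - m) (- t k)) ⟩
      s k + (- l + (- - m - t k))            ≈⟨ +-assoc (s k) (- l) _ ⟨
      (s k - l) + (- - m - t k)              ≈⟨ +-congˡ (+-comm _ _) ⟩
      (s k - l) + (- t k - - m)              ≈⟨ +-congˡ (-‿+-comm (t k) (- m)) ⟩
      (s k - l) + - (t k - m)                ∎

  infix  4 _≋_
  infixl 7 _⊗_
  infixl 6 _⊕_
  infixr 7 _·ᴹ_
  infix  9 _ᵀ

  Matrix : ℕ → ℕ → Set
  Matrix m n = Fin m → Fin n → ℝ

  _≋_ : ∀ {m n} → Matrix m n → Matrix m n → Set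
  A ≋ B = ∀ i j → A i j ≈ B i j

  0ᴹ : ∀ {m n} → Matrix m n
  0ᴹ _ _ = 0#

  1ᴹ : ∀ {n} → Matrix n n
  1ᴹ i j = if does (i Fin.≟ j) then 1# else 0#

  _⊕_ : ∀ {m n} → Matrix m n → Matrix m n → Matrix m n
  (A ⊕ B) i j = A i j + B i j

  _·ᴹ_ : ∀ {m n} → ℝ → Matrix m n → Matrix m n
  (c ·ᴹ A) i j = c * A i j

  -ᴹ_ : ∀ {m n} → Matrix m n → Matrix m n
  (-ᴹ A) i j = - A i j

  _⊗_ : ∀ {l m n} → Matrix l m → Matrix m n → Matrix l n
  _⊗_ {m = m} A B i j = ∑[ k < m ] (A i k * B k j)

  _ᵀ : ∀ {m n} → Matrix m n → Matrix n m
  (A ᵀ) i j = A j i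

  Tr : ∀ {n} → Matrix n n → ℝ
  Tr {n} A = ∑[ i < n ] A i i

  -- Index r of Fin (n * d) is entry (remainder d r) of block (quotient d r).

  fromBlocks : ∀ {n m d e} → (Fin n → Fin m → Matrix d e) → Matrix (n ℕ.* d) (m ℕ.* e)
  fromBlocks {n} {m} {d} {e} B r c =
    B (quotient d r) (quotient e c) (remainder {n} d r) (remainder {m} e c)

  fromBlockColumn : ∀ {n d e} → (Fin n → Matrix d e) → Matrix (n ℕ.* d) e
  fromBlockColumn {n} {d} B r c = B (quotient d r) (remainder {n} d r) c

  IsOrthogonal : ∀ {d} → Matrix d d → Set
  IsOrthogonal A = A ᵀ ⊗ A ≋ 1ᴹ

  O : ℕ → Set
  O d = Σ (Matrix d d) IsOrthogonal

  record IsMoorePenroseInverse {m n} (A : Matrix m n) (X : Matrix n m) : Set where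
    field
      AXA≋A   : A ⊗ X ⊗ A ≋ A
      XAX≋X   : X ⊗ A ⊗ X ≋ X
      AX-symm : (A ⊗ X) ᵀ ≋ A ⊗ X
      XA-symm : (X ⊗ A) ᵀ ≋ X ⊗ A

  ≋-sym : ∀ {m n} {A B : Matrix m n} → A ≋ B → B ≋ A
  ≋-sym p i j = sym (p i j)

  ≋-trans : ∀ {m n} {A B C : Matrix m n} → A ≋ B → B ≋ C → A ≋ C
  ≋-trans p q i j = trans (p i j) (q i j)

  ᵀ-cong : ∀ {m n} {A B : Matrix m n} → A ≋ B → A ᵀ ≋ B ᵀ
  ᵀ-cong p i j = p j i

  ⊗-congʳ : ∀ {l m n} {A B : Matrix l m} (C : Matrix m n) → A ≋ B → A ⊗ C ≋ B ⊗ C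
  ⊗-congʳ C p i j = sum-cong-≋ (λ k → *-congʳ (p i k))

  ⊗-congˡ : ∀ {l m n} (C : Matrix l m) {A B : Matrix m n} → A ≋ B → C ⊗ A ≋ C ⊗ B
  ⊗-congˡ C p i j = sum-cong-≋ (λ k → *-congˡ (p k j))

  ⊗-ᵀ : ∀ {l m n} (A : Matrix l m) (B : Matrix m n) → (A ⊗ B) ᵀ ≋ B ᵀ ⊗ A ᵀ
  ⊗-ᵀ A B i j = sum-cong-≋ (λ k → *-comm (A j k) (B k i))

  ⊗-assoc : ∀ {k l m n} (A : Matrix k l) (B : Matrix l m) (C : Matrix m n) →
            A ⊗ B ⊗ C ≋ A ⊗ (B ⊗ C)
  ⊗-assoc {k} {l} {m} A B C i j = begin-equality
    ∑[ q < m ] ((A ⊗ B) i q * C q j)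
      ≈⟨ sum-cong-≋ (λ q → *-distribʳ-sum (C q j) (λ p → A i p * B p q)) ⟩
    ∑[ q < m ] ∑[ p < l ] (A i p * B p q * C q j)
      ≈⟨ ∑-comm {m} {l} (λ q p → A i p * B p q * C q j) ⟩
    ∑[ p < l ] ∑[ q < m ] (A i p * B p q * C q j)
      ≈⟨ sum-cong-≋ (λ p → sum-cong-≋ (λ q → *-assoc (A i p) (B p q) (C q j))) ⟩
    ∑[ p < l ] ∑[ q < m ] (A i p * (B p q * C q j))
      ≈⟨ sum-cong-≋ (λ p → *-distribˡ-sum (A i p) (λ q → B p q * C q j)) ⟨
    ∑[ p < l ] (A i p * (B ⊗ C) p j) ∎

  sum-1ᴹ : ∀ {n} (f : Fin n → ℝ) l → ∑[ i < n ] (f i * 1ᴹ i l) ≈ f l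
  sum-1ᴹ {suc n} f zero = begin-equality
    f zero * 1# + ∑[ i < n ] (f (suc i) * 0#)
      ≈⟨ +-cong (*-identityʳ _) (sum-zero (λ i → zeroʳ (f (suc i)))) ⟩
    f zero + 0# ≈⟨ +-identityʳ _ ⟩
    f zero      ∎
  sum-1ᴹ {suc n} f (suc l) = begin-equality
    f zero * 0# + ∑[ i < n ] (f (suc i) * 1ᴹ i l)
      ≈⟨ +-cong (zeroʳ _) (sum-1ᴹ (f ∘ suc) l) ⟩
    0# + f (suc l) ≈⟨ +-identityˡ _ ⟩
    f (suc l)      ∎

  1ᴹ-symm : ∀ {n} (i j : Fin n) → 1ᴹ i j ≈ 1ᴹ j i
  1ᴹ-symm i j with i Fin.≟ j | j Fin.≟ i
  ... | yes _ | yes _ = refl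
  ... | no _  | no _  = refl
  ... | yes p | no q  = ⊥-elim (q (≡.sym p))
  ... | no p  | yes q = ⊥-elim (p (≡.sym q))

  ⊗-identityˡ : ∀ {m n} (A : Matrix m n) → 1ᴹ ⊗ A ≋ A
  ⊗-identityˡ A i j = trans
    (sum-cong-≋ (λ k → trans (*-comm _ _) (*-congˡ (1ᴹ-symm i k))))
    (sum-1ᴹ (λ k → A k j) i)

  -- Existence of the Moore–Penrose inverse.  The normal equations
  -- Aᵀ A u = Aᵀ v are solved by induction on the columns of A.  If
  -- Aᵀ A U = Aᵀ and A Aᵀ V = A, then Vᵀ A U is the Moore–Penrose inverse.

  ⟨_,_⟩ : ∀ {n} → (Fin n → ℝ) → (Fin n → ℝ) → ℝ
  ⟨_,_⟩ {n} x y = ∑[ i < n ] (x i * y i)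

  ⟨⟩-sub : ∀ {n} (x y z : Fin n → ℝ) t →
           ⟨ x , (λ i → y i - t * z i) ⟩ ≈ ⟨ x , y ⟩ - t * ⟨ x , z ⟩
  ⟨⟩-sub {n} x y z t = begin-equality
    ∑[ i < n ] (x i * (y i - t * z i))
      ≈⟨ sum-cong-≋ pointwise ⟩
    ∑[ i < n ] (x i * y i + - t * (x i * z i))
      ≈⟨ ∑-distrib-+ (λ i → x i * y i) (λ i → - t * (x i * z i)) ⟩
    ⟨ x , y ⟩ + ∑[ i < n ] (- t * (x i * z i))
      ≈⟨ +-congˡ (*-distribˡ-sum (- t) (λ i → x i * z i)) ⟨
    ⟨ x , y ⟩ + - t * ⟨ x , z ⟩
      ≈⟨ +-congˡ (-‿distribˡ-* t _) ⟨
    ⟨ x , y ⟩ - t * ⟨ x , z ⟩ ∎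
    where
    pointwise : ∀ i → x i * (y i - t * z i) ≈ x i * y i + - t * (x i * z i)
    pointwise i = begin-equality
      x i * (y i - t * z i)             ≈⟨ distribˡ _ _ _ ⟩
      x i * y i + x i * - (t * z i)     ≈⟨ +-congˡ (*-congˡ (-‿distribˡ-* t (z i))) ⟩
      x i * y i + x i * (- t * z i)     ≈⟨ +-congˡ (*-assoc (x i) (- t) (z i)) ⟨
      x i * y i + x i * - t * z i       ≈⟨ +-congˡ (*-congʳ (*-comm (x i) (- t))) ⟩
      x i * y i + - t * x i * z i       ≈⟨ +-congˡ (*-assoc (- t) (x i) (z i)) ⟩
      x i * y i + - t * (x i * z i)     ∎

  ⟨⟩-orth : ∀ {m n} (B : Matrix m n) (u : Fin n → ℝ) (y : Fin m → ℝ) →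
            (∀ k → ⟨ (λ i → B i k) , y ⟩ ≈ 0#) → ⟨ (λ i → ⟨ B i , u ⟩) , y ⟩ ≈ 0#
  ⟨⟩-orth {m} {n} B u y B⊥y = begin-equality
    ∑[ i < m ] (⟨ B i , u ⟩ * y i)
      ≈⟨ sum-cong-≋ (λ i → *-distribʳ-sum (y i) (λ k → B i k * u k)) ⟩
    ∑[ i < m ] ∑[ k < n ] (B i k * u k * y i)
      ≈⟨ ∑-comm {m} {n} (λ i k → B i k * u k * y i) ⟩
    ∑[ k < n ] ∑[ i < m ] (B i k * u k * y i)
      ≈⟨ sum-cong-≋ (λ k → sum-cong-≋ (λ i → trans (*-congʳ (*-comm (B i k) (u k))) (*-assoc (u k) (B i k) (y i)))) ⟩
    ∑[ k < n ] ∑[ i < m ] (u k * (B i k * y i))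
      ≈⟨ sum-cong-≋ (λ k → *-distribˡ-sum (u k) (λ i → B i k * y i)) ⟨
    ∑[ k < n ] (u k * ⟨ (λ i → B i k) , y ⟩)
      ≈⟨ sum-zero (λ k → trans (*-congˡ (B⊥y k)) (zeroʳ (u k))) ⟩
    0# ∎

  leastSquares : ∀ {m n} (A : Matrix m n) (v : Fin m → ℝ) →
                 ∃[ u ] ∀ k → ⟨ (λ i → A i k) , (λ i → v i - ⟨ A i , u ⟩) ⟩ ≈ 0#
  leastSquares {m} {zero}  A v = (λ ()) , λ ()
  leastSquares {m} {suc n} A v = u , normal
    where
    a : Fin m → ℝ
    a i = A i zero
    B : Matrix m n
    B i k = A i (suc k)
    uᵥ = proj₁ (leastSquares B v)
    uₐ = proj₁ (leastSquares B a)
    r c : Fin m → ℝ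
    r i = v i - ⟨ B i , uᵥ ⟩
    c i = a i - ⟨ B i , uₐ ⟩
    B⊥r : ∀ k → ⟨ (λ i → B i k) , r ⟩ ≈ 0#
    B⊥r = proj₂ (leastSquares B v)
    B⊥c : ∀ k → ⟨ (λ i → B i k) , c ⟩ ≈ 0#
    B⊥c = proj₂ (leastSquares B a)

    coefficient : ∃[ t ] ⟨ c , r ⟩ ≈ t * ⟨ c , c ⟩
    coefficient with ⟨ c , c ⟩ ≟ 0#
    ... | yes p = 0# , trans
      (sum-zero (λ i → trans (*-congʳ (sum-sq-zero c p i)) (zeroˡ (r i))))
      (sym (zeroˡ _))
    ... | no p = ⟨ c , r ⟩ / ⟨ c , c ⟩ , (begin-equality
      ⟨ c , r ⟩                                    ≈⟨ *-identityʳ _ ⟨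
      ⟨ c , r ⟩ * 1#                               ≈⟨ *-congˡ (*-⁻¹ p) ⟨
      ⟨ c , r ⟩ * (⟨ c , c ⟩ * ⟨ c , c ⟩ ⁻¹)       ≈⟨ *-congˡ (*-comm _ _) ⟩
      ⟨ c , r ⟩ * (⟨ c , c ⟩ ⁻¹ * ⟨ c , c ⟩)       ≈⟨ *-assoc _ _ _ ⟨
      ⟨ c , r ⟩ / ⟨ c , c ⟩ * ⟨ c , c ⟩            ∎)

    t = proj₁ coefficient

    u : Fin (suc n) → ℝ
    u zero    = t
    u (suc k) = uᵥ k - t * uₐ k

    residual : ∀ i → v i - ⟨ A i , u ⟩ ≈ r i - t * c i
    residual i = begin-equality
      v i - (a i * t + ⟨ B i , (λ k → uᵥ k - t * uₐ k) ⟩)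
        ≈⟨ +-congˡ (-‿cong (+-congˡ (⟨⟩-sub (B i) uᵥ uₐ t))) ⟩
      v i - (a i * t + (p - t * q))
        ≈⟨ +-congˡ (-‿+-comm _ _) ⟨
      v i + (- (a i * t) - (p - t * q))
        ≈⟨ +-congˡ (+-congˡ (-‿+-comm p _)) ⟨
      v i + (- (a i * t) + (- p - - (t * q)))
        ≈⟨ +-congˡ (+-comm _ _) ⟩
      v i + ((- p - - (t * q)) + - (a i * t))
        ≈⟨ +-congˡ (+-assoc _ _ _) ⟩
      v i + (- p + (- - (t * q) + - (a i * t)))
        ≈⟨ +-assoc _ _ _ ⟨
      (v i - p) + (- - (t * q) + - (a i * t))
        ≈⟨ +-congˡ (-‿+-comm _ _) ⟩
      (v i - p) - (- (t * q) + a i * t)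
        ≈⟨ +-congˡ (-‿cong factor) ⟩
      (v i - p) - t * (a i - q) ∎
      where
      p = ⟨ B i , uᵥ ⟩
      q = ⟨ B i , uₐ ⟩
      factor : - (t * q) + a i * t ≈ t * (a i - q)
      factor = begin-equality
        - (t * q) + a i * t   ≈⟨ +-comm _ _ ⟩
        a i * t - t * q       ≈⟨ +-cong (*-comm (a i) t) (-‿distribʳ-* t q) ⟩
        t * a i + t * - q     ≈⟨ distribˡ t (a i) (- q) ⟨
        t * (a i - q)         ∎

    against : ∀ x → ⟨ x , (λ i → v i - ⟨ A i , u ⟩) ⟩ ≈ ⟨ x , r ⟩ - t * ⟨ x , c ⟩
    against x = trans (sum-cong-≋ (λ i → *-congˡ (residual i))) (⟨⟩-sub x r c t)

    a-part : ∀ y → (∀ k → ⟨ (λ i → B i k) , y ⟩ ≈ 0#) → ⟨ a , y ⟩ ≈ ⟨ c , y ⟩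
    a-part y B⊥y = begin-equality
      ⟨ a , y ⟩
        ≈⟨ sum-cong-≋ (λ i → trans (*-congʳ (sym (+-cancel-neg (a i) ⟨ B i , uₐ ⟩))) (distribʳ (y i) (c i) _)) ⟩
      ∑[ i < m ] (c i * y i + ⟨ B i , uₐ ⟩ * y i)
        ≈⟨ ∑-distrib-+ (λ i → c i * y i) (λ i → ⟨ B i , uₐ ⟩ * y i) ⟩
      ⟨ c , y ⟩ + ⟨ (λ i → ⟨ B i , uₐ ⟩) , y ⟩
        ≈⟨ +-congˡ (⟨⟩-orth B uₐ y B⊥y) ⟩
      ⟨ c , y ⟩ + 0#
        ≈⟨ +-identityʳ _ ⟩
      ⟨ c , y ⟩ ∎

    normal : ∀ k → ⟨ (λ i → A i k) , (λ i → v i - ⟨ A i , u ⟩) ⟩ ≈ 0#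
    normal zero = begin-equality
      ⟨ a , (λ i → v i - ⟨ A i , u ⟩) ⟩   ≈⟨ against a ⟩
      ⟨ a , r ⟩ - t * ⟨ a , c ⟩
        ≈⟨ +-cong (a-part r B⊥r) (-‿cong (*-congˡ (a-part c B⊥c))) ⟩
      ⟨ c , r ⟩ - t * ⟨ c , c ⟩           ≈⟨ +-congʳ (proj₂ coefficient) ⟩
      t * ⟨ c , c ⟩ - t * ⟨ c , c ⟩       ≈⟨ -‿inverseʳ _ ⟩
      0#                                  ∎
    normal (suc k) = begin-equality
      ⟨ b , (λ i → v i - ⟨ A i , u ⟩) ⟩   ≈⟨ against b ⟩
      ⟨ b , r ⟩ - t * ⟨ b , c ⟩
        ≈⟨ +-cong (B⊥r k) (-‿cong (trans (*-congˡ (B⊥c k)) (zeroʳ t))) ⟩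
      0# - 0#                             ≈⟨ -‿inverseʳ 0# ⟩
      0#                                  ∎
      where
      b : Fin m → ℝ
      b i = B i k

  normalEquations : ∀ {m n} (A : Matrix m n) → ∃[ U ] A ᵀ ⊗ (A ⊗ U) ≋ A ᵀ
  normalEquations {m} {n} A = U , solves
    where
    e : Fin m → Fin m → ℝ
    e l i = 1ᴹ i l

    U : Matrix n m
    U k l = proj₁ (leastSquares A (e l)) k

    solves : A ᵀ ⊗ (A ⊗ U) ≋ A ᵀ
    solves k l = begin-equality
      ⟨ x , y ⟩                       ≈⟨ +-identityˡ _ ⟨
      0# + ⟨ x , y ⟩                  ≈⟨ +-congʳ orth ⟨
      (A l k - ⟨ x , y ⟩) + ⟨ x , y ⟩ ≈⟨ +-cancel-neg _ _ ⟩
      A l k                           ∎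
      where
      x y : Fin m → ℝ
      x i = A i k
      y i = (A ⊗ U) i l
      orth : A l k - ⟨ x , y ⟩ ≈ 0#
      orth = begin-equality
        A l k - ⟨ x , y ⟩
          ≈⟨ +-cong (sym (sum-1ᴹ x l)) (-‿cong (sym (*-identityˡ _))) ⟩
        ⟨ x , e l ⟩ - 1# * ⟨ x , y ⟩
          ≈⟨ ⟨⟩-sub x (e l) y 1# ⟨
        ⟨ x , (λ i → e l i - 1# * y i) ⟩
          ≈⟨ sum-cong-≋ (λ i → *-congˡ (+-congˡ (-‿cong (*-identityˡ (y i))))) ⟩
        ⟨ x , (λ i → e l i - y i) ⟩
          ≈⟨ proj₂ (leastSquares A (e l)) k ⟩
        0# ∎

  normal⇒symm : ∀ {m n} (A : Matrix m n) (U : Matrix n m) →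
                A ᵀ ⊗ (A ⊗ U) ≋ A ᵀ → (A ⊗ U) ᵀ ≋ A ⊗ U
  normal⇒symm A U p = ≋-trans gram (≋-trans gram-symm (ᵀ-cong (≋-sym gram)))
    where
    gram : (A ⊗ U) ᵀ ≋ (A ⊗ U) ᵀ ⊗ (A ⊗ U)
    gram = ≋-trans (⊗-ᵀ A U) (≋-trans (⊗-congˡ (U ᵀ) (≋-sym p))
      (≋-trans (≋-sym (⊗-assoc (U ᵀ) (A ᵀ) (A ⊗ U))) (⊗-congʳ (A ⊗ U) (≋-sym (⊗-ᵀ A U)))))
    gram-symm : (A ⊗ U) ᵀ ⊗ (A ⊗ U) ≋ ((A ⊗ U) ᵀ ⊗ (A ⊗ U)) ᵀ
    gram-symm = ≋-sym (⊗-ᵀ ((A ⊗ U) ᵀ) (A ⊗ U))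

  normal⇒AUA : ∀ {m n} (A : Matrix m n) (U : Matrix n m) →
               A ᵀ ⊗ (A ⊗ U) ≋ A ᵀ → A ⊗ U ⊗ A ≋ A
  normal⇒AUA A U p =
    ≋-trans (⊗-congʳ A (≋-sym (normal⇒symm A U p)))
    (≋-trans (≋-sym (⊗-ᵀ (A ᵀ) (A ⊗ U))) (ᵀ-cong p))

  moorePenrose : ∀ {m n} (A : Matrix m n) → ∃ (IsMoorePenroseInverse A)
  moorePenrose A = X , record
    { AXA≋A   = ≋-trans (⊗-congʳ A AX≋AU) AUA
    ; XAX≋X   = ≋-trans (⊗-congʳ X XA≋WA) (≋-trans (≋-sym (⊗-assoc (W ⊗ A) (W ⊗ A) U))
                  (⊗-congʳ U (≋-trans (⊗-assoc W A (W ⊗ A)) (⊗-congˡ W AWA))))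
    ; AX-symm = ≋-trans (ᵀ-cong AX≋AU) (≋-trans AU-symm (≋-sym AX≋AU))
    ; XA-symm = ≋-trans (ᵀ-cong XA≋WA) (≋-trans WA-symm (≋-sym XA≋WA))
    }
    where
    U = proj₁ (normalEquations A)
    V = proj₁ (normalEquations (A ᵀ))
    W = V ᵀ
    X = W ⊗ A ⊗ U

    AU-symm : (A ⊗ U) ᵀ ≋ A ⊗ U
    AU-symm = normal⇒symm A U (proj₂ (normalEquations A))
    AUA : A ⊗ U ⊗ A ≋ A
    AUA = normal⇒AUA A U (proj₂ (normalEquations A))
    AV-symm : (A ᵀ ⊗ V) ᵀ ≋ A ᵀ ⊗ V
    AV-symm = normal⇒symm (A ᵀ) V (proj₂ (normalEquations (A ᵀ)))

    WA-symm : (W ⊗ A) ᵀ ≋ W ⊗ A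
    WA-symm = ≋-trans (⊗-ᵀ W A) (≋-trans (≋-sym AV-symm) (⊗-ᵀ (A ᵀ) V))

    AWA : A ⊗ (W ⊗ A) ≋ A
    AWA = ≋-trans (⊗-congˡ A (≋-sym (⊗-ᵀ (A ᵀ) V))) (≋-trans (≋-sym (⊗-ᵀ (A ᵀ ⊗ V) (A ᵀ)))
      (ᵀ-cong (normal⇒AUA (A ᵀ) V (proj₂ (normalEquations (A ᵀ))))))

    AX≋AU : A ⊗ X ≋ A ⊗ U
    AX≋AU = ≋-trans (≋-sym (⊗-assoc A (W ⊗ A) U)) (⊗-congʳ U AWA)

    XA≋WA : X ⊗ A ≋ W ⊗ A
    XA≋WA = ≋-trans (⊗-assoc (W ⊗ A) U A) (≋-trans (⊗-assoc W A (U ⊗ A))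
      (⊗-congˡ W (≋-trans (≋-sym (⊗-assoc A U A)) AUA)))

  infix 9 _†

  abstract

    _† : ∀ {m n} → Matrix m n → Matrix n m
    A † = proj₁ (moorePenrose A)

    †-isMoorePenroseInverse : ∀ {m n} (A : Matrix m n) → IsMoorePenroseInverse A (A †)
    †-isMoorePenroseInverse A = proj₂ (moorePenrose A)

  -- The edge set is determined by the weights.
  record WeightedGraph (n : ℕ) : Set where
    field
      w          : Fin n → Fin n → ℝ
      w-symm     : ∀ x y → w x y ≈ w y x
      w-nonneg   : ∀ x y → 0# ≤ w x y
      w-loopless : ∀ x → w x x ≈ 0#

    Edge : Fin n → Fin n → Set
    Edge x y = 0# < w x y

    Connected : Set
    Connected = ∀ x y → Star Edge x y

    deg : Fin n → ℝ
    deg x = ∑[ y < n ] w x y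

    -- The transition probabilities of the simple random walk.
    p : Fin n → Fin n → ℝ
    p x y = w x y / deg x

    p-nonneg : ∀ x y → 0# ≤ p x y
    p-nonneg x y = *-nonneg (w-nonneg x y) (⁻¹-nonneg (sum-nonneg (w-nonneg x)))

    ∑p≤1 : ∀ x → ∑[ y < n ] p x y ≤ 1#
    ∑p≤1 x with deg x ≟ 0#
    ... | yes _ = ≤-trans (≈⇒≤ (sum-zero (λ y → zeroʳ (w x y)))) (inj₁ 0<1)
    ... | no q  = ≈⇒≤ (trans (sym (*-distribʳ-sum _ (w x))) (proj₂ (invertible (deg x) q)))

  -- Expectations up to a hitting time.  A trajectory X₀ , … , X_t is given
  -- by its starting node and the word X₁ , … , X_t.

  sumWords : ∀ {n} t → (Vec (Fin n) t → ℝ) → ℝ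
  sumWords     zero    f = f []
  sumWords {n} (suc t) f = ∑[ y < n ] sumWords t (λ ys → f (y ∷ ys))

  sumWords-cong : ∀ {n} t {f g : Vec (Fin n) t → ℝ} →
                  (∀ xs → f xs ≈ g xs) → sumWords t f ≈ sumWords t g
  sumWords-cong zero    q = q []
  sumWords-cong (suc t) q = sum-cong-≋ (λ y → sumWords-cong t (λ ys → q (y ∷ ys)))

  sumWords-mono-≤ : ∀ {n} t {f g : Vec (Fin n) t → ℝ} →
                    (∀ xs → f xs ≤ g xs) → sumWords t f ≤ sumWords t g
  sumWords-mono-≤ zero    q = q []
  sumWords-mono-≤ (suc t) q = sum-mono-≤ (λ y → sumWords-mono-≤ t (λ ys → q (y ∷ ys)))

  sumWords-zero : ∀ {n} t {f : Vec (Fin n) t → ℝ} → (∀ xs → f xs ≈ 0#) → sumWords t f ≈ 0#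
  sumWords-zero zero    q = q []
  sumWords-zero (suc t) q = sum-zero (λ y → sumWords-zero t (λ ys → q (y ∷ ys)))

  sumWords-distrib-+ : ∀ {n} t (f g : Vec (Fin n) t → ℝ) →
                       sumWords t (λ xs → f xs + g xs) ≈ sumWords t f + sumWords t g
  sumWords-distrib-+ zero    f g = refl
  sumWords-distrib-+ (suc t) f g = trans
    (sum-cong-≋ (λ y → sumWords-distrib-+ t (λ ys → f (y ∷ ys)) (λ ys → g (y ∷ ys))))
    (∑-distrib-+ (λ y → sumWords t (λ ys → f (y ∷ ys))) (λ y → sumWords t (λ ys → g (y ∷ ys))))

  *-distribˡ-sumWords : ∀ {n} t c (f : Vec (Fin n) t → ℝ) →
                        sumWords t (λ xs → c * f xs) ≈ c * sumWords t f
  *-distribˡ-sumWords zero    c f = refl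
  *-distribˡ-sumWords (suc t) c f = trans
    (sum-cong-≋ (λ y → *-distribˡ-sumWords t c (λ ys → f (y ∷ ys))))
    (sym (*-distribˡ-sum c (λ y → sumWords t (λ ys → f (y ∷ ys)))))

  -- The event T_j = t, where T_j is the hitting time of j (so T_j = 0 from j).
  FirstHits : ∀ {n t} → Fin n → Fin n → Vec (Fin n) t → Set
  FirstHits j x []       = x ≡ j
  FirstHits j x (y ∷ ys) = x ≢ j × FirstHits j y ys

  firstHits? : ∀ {n t} (j x : Fin n) (xs : Vec (Fin n) t) → Dec (FirstHits j x xs)
  firstHits? j x []       = x Fin.≟ j
  firstHits? j x (y ∷ ys) = ¬? (x Fin.≟ j) ×-dec firstHits? j y ys

  Functional : ℕ → Set
  Functional n = ∀ {t} → Fin n → Vec (Fin n) t → ℝ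

  module Walk {n} (G : WeightedGraph n) where

    open WeightedGraph G

    probability : Functional n
    probability x []       = 1#
    probability x (y ∷ ys) = p x y * probability y ys

    probability-nonneg : ∀ {t} x (xs : Vec (Fin n) t) → 0# ≤ probability x xs
    probability-nonneg x []       = inj₁ 0<1
    probability-nonneg x (y ∷ ys) = *-nonneg (p-nonneg x y) (probability-nonneg y ys)

    -- 𝔼[ 1_{T_j = t} Z(X₀ , … , X_t) ∣ X₀ = i ]
    expectationAt : Functional n → Fin n → Fin n → ℕ → ℝ
    expectationAt Z j i t = sumWords t λ xs →
      if does (firstHits? j i xs) then probability i xs * Z i xs else 0#

    -- 𝔼[ Z(X₀ , … , X_{T_j}) ∣ X₀ = i ] = e.  The stopped trajectory takes
    -- countably many values, so this is a sum over finite words.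
    IsHittingExpectation : Functional n → Fin n → Fin n → ℝ → Set
    IsHittingExpectation Z j i e = HasSum (expectationAt Z j i) e

    mass : Fin n → Fin n → ℕ → ℝ
    mass = expectationAt (λ _ _ → 1#)

    mass-suc : ∀ j i t → i ≢ j → mass j i (suc t) ≈ ∑[ y < n ] (p i y * mass j y t)
    mass-suc j i t i≢j with i Fin.≟ j
    ... | yes i≡j = ⊥-elim (i≢j i≡j)
    ... | no _    = sum-cong-≋ λ y → trans (sumWords-cong t (pull y)) (*-distribˡ-sumWords t (p i y) _)
      where
      pull : ∀ y ys →
             (if does (firstHits? j y ys) then p i y * probability y ys * 1# else 0#) ≈
             p i y * (if does (firstHits? j y ys) then probability y ys * 1# else 0#)
      pull y ys with does (firstHits? j y ys)
      ... | true  = *-assoc _ _ _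
      ... | false = sym (zeroʳ _)

    mass-suc-≡ : ∀ j t → mass j j (suc t) ≈ 0#
    mass-suc-≡ j t with j Fin.≟ j
    ... | yes _  = sum-zero {n} (λ y → sumWords-zero {n} t (λ _ → refl))
    ... | no j≢j = ⊥-elim (j≢j ≡.refl)

    mass-zero : ∀ j i → i ≢ j → mass j i 0 ≈ 0#
    mass-zero j i i≢j with i Fin.≟ j
    ... | yes i≡j = ⊥-elim (i≢j i≡j)
    ... | no _    = refl

    mass-zero-≡ : ∀ j → mass j j 0 ≈ 1#
    mass-zero-≡ j with j Fin.≟ j
    ... | yes _  = *-identityʳ 1#
    ... | no j≢j = ⊥-elim (j≢j ≡.refl)

    ∑mass≤1 : ∀ N j i → partialSum (mass j i) N ≤ 1#
    ∑mass≤1 zero    j i = inj₁ 0<1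
    ∑mass≤1 (suc N) j i = by-cases (i Fin.≟ j)
      where
      by-cases : Dec (i ≡ j) → partialSum (mass j i) (suc N) ≤ 1#
      by-cases (yes ≡.refl) = ≈⇒≤ (trans
        (+-cong (mass-zero-≡ j) (sum-zero (λ t → mass-suc-≡ j (toℕ {N} t))))
        (+-identityʳ 1#))
      by-cases (no i≢j) = begin
        mass j i 0 + ∑[ t < N ] mass j i (suc (toℕ t))
          ≈⟨ +-cong (mass-zero j i i≢j) (sum-cong-≋ (λ t → mass-suc j i (toℕ {N} t) i≢j)) ⟩
        0# + ∑[ t < N ] ∑[ y < n ] (p i y * mass j y (toℕ t))
          ≈⟨ +-identityˡ _ ⟩
        ∑[ t < N ] ∑[ y < n ] (p i y * mass j y (toℕ t))
          ≈⟨ ∑-comm {N} {n} (λ t y → p i y * mass j y (toℕ t)) ⟩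
        ∑[ y < n ] ∑[ t < N ] (p i y * mass j y (toℕ t))
          ≈⟨ sum-cong-≋ (λ y → *-distribˡ-sum {N} (p i y) (λ t → mass j y (toℕ t))) ⟨
        ∑[ y < n ] (p i y * partialSum (mass j y) N)
          ≤⟨ sum-mono-≤ (λ y → *-monoʳ-≤ (p-nonneg i y) (∑mass≤1 N j y)) ⟩
        ∑[ y < n ] (p i y * 1#)
          ≈⟨ sum-cong-≋ (λ y → *-identityʳ (p i y)) ⟩
        ∑[ y < n ] p i y
          ≤⟨ ∑p≤1 i ⟩
        1# ∎

    mass-nonneg : ∀ j i t → 0# ≤ mass j i t
    mass-nonneg j i t = ≤-trans
      (≈⇒≤ (sym (sumWords-zero {n} t (λ _ → refl)))) (sumWords-mono-≤ t nonneg)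
      where
      nonneg : ∀ xs → 0# ≤ (if does (firstHits? j i xs) then probability i xs * 1# else 0#)
      nonneg xs with does (firstHits? j i xs)
      ... | true  = *-nonneg (probability-nonneg i xs) (inj₁ 0<1)
      ... | false = inj₂ refl

    -- A functional with values in [-1 , 1] has an expectation: both 1 and
    -- Z + 1 are nonnegative and bounded, and the walk has total mass at most 1.

    hittingExpectation : (Z : Functional n) →
      (∀ {t} x (xs : Vec (Fin n) t) → Z x xs ≤ 1#) →
      (∀ {t} x (xs : Vec (Fin n) t) → - Z x xs ≤ 1#) →
      ∀ j i → ∃ (IsHittingExpectation Z j i)
    hittingExpectation Z Z≤1 -Z≤1 j i =
      proj₁ summable⁺ - proj₁ summable¹ ,
      ⟶-diff split (proj₂ summable⁺) (proj₂ summable¹)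
      where
      Z⁺ : Functional n
      Z⁺ x xs = Z x xs + 1#

      f⁺ : ℕ → ℝ
      f⁺ = expectationAt Z⁺ j i

      Z⁺-nonneg : ∀ {t} x (xs : Vec (Fin n) t) → 0# ≤ Z⁺ x xs
      Z⁺-nonneg x xs = ≤-trans (≤⇒0≤- (-Z≤1 x xs))
        (≈⇒≤ (trans (+-congˡ (neg-involutive _)) (+-comm _ _)))

      f⁺-nonneg : ∀ t → 0# ≤ f⁺ t
      f⁺-nonneg t = ≤-trans (≈⇒≤ (sym (sumWords-zero {n} t (λ _ → refl)))) (sumWords-mono-≤ t nonneg)
        where
        nonneg : ∀ xs → 0# ≤ (if does (firstHits? j i xs) then probability i xs * Z⁺ i xs else 0#)
        nonneg xs with does (firstHits? j i xs)
        ... | true  = *-nonneg (probability-nonneg i xs) (Z⁺-nonneg i xs)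
        ... | false = inj₂ refl

      f⁺≤ : ∀ t → f⁺ t ≤ mass j i t + mass j i t
      f⁺≤ t = ≤-trans (sumWords-mono-≤ t bound) (≈⇒≤ (sumWords-distrib-+ t _ _))
        where
        indicator : Vec (Fin n) t → ℝ
        indicator xs = if does (firstHits? j i xs) then probability i xs * 1# else 0#
        bound : ∀ xs → (if does (firstHits? j i xs) then probability i xs * Z⁺ i xs else 0#) ≤
                       indicator xs + indicator xs
        bound xs with does (firstHits? j i xs)
        ... | true  = ≤-trans
          (*-monoʳ-≤ (probability-nonneg i xs) (+-monoˡ-≤ 1# (Z≤1 i xs)))
          (≈⇒≤ (distribˡ _ 1# 1#))
        ... | false = ≈⇒≤ (sym (+-identityʳ 0#))

      ∑f⁺≤2 : ∀ N → partialSum f⁺ N ≤ 1# + 1#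
      ∑f⁺≤2 N = begin
        partialSum f⁺ N
          ≤⟨ sum-mono-≤ (λ t → f⁺≤ (toℕ {N} t)) ⟩
        ∑[ t < N ] (mass j i (toℕ t) + mass j i (toℕ t))
          ≈⟨ ∑-distrib-+ {N} (λ t → mass j i (toℕ t)) (λ t → mass j i (toℕ t)) ⟩
        partialSum (mass j i) N + partialSum (mass j i) N
          ≤⟨ +-mono-≤ (∑mass≤1 N j i) (∑mass≤1 N j i) ⟩
        1# + 1# ∎

      summable⁺ : Summable f⁺
      summable⁺ = nonneg-summable {f⁺} f⁺-nonneg (1# + 1#) ∑f⁺≤2

      summable¹ : Summable (mass j i)
      summable¹ = nonneg-summable {mass j i} (mass-nonneg j i) 1# (λ N → ∑mass≤1 N j i)

      termwise : ∀ t → f⁺ t ≈ expectationAt Z j i t + mass j i t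
      termwise t = trans (sumWords-cong t pointwise) (sumWords-distrib-+ t _ _)
        where
        pointwise : ∀ xs →
          (if does (firstHits? j i xs) then probability i xs * Z⁺ i xs else 0#) ≈
          (if does (firstHits? j i xs) then probability i xs * Z i xs else 0#) +
          (if does (firstHits? j i xs) then probability i xs * 1# else 0#)
        pointwise xs with does (firstHits? j i xs)
        ... | true  = distribˡ _ _ _
        ... | false = sym (+-identityʳ 0#)

      split : ∀ N → partialSum f⁺ N ≈ partialSum (expectationAt Z j i) N + partialSum (mass j i) N
      split N = trans (sum-cong-≋ (λ t → termwise (toℕ {N} t)))
        (∑-distrib-+ {N} (λ t → expectationAt Z j i (toℕ t)) (λ t → mass j i (toℕ t)))

  -- One matrix per oriented edge; the proof of being an edge is irrelevant.
  record Signature {n} (G : WeightedGraph n) (d : ℕ) : Set where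
    open WeightedGraph G
    field
      σ       : ∀ x y → .(Edge x y) → O d
      σ-symm  : ∀ x y .(e : Edge x y) .(e′ : Edge y x) → proj₁ (σ y x e′) ≋ proj₁ (σ x y e) ᵀ

    -- σ extended by zero to all pairs of nodes.
    σ₀ : Fin n → Fin n → Matrix d d
    σ₀ x y with 0# <? w x y
    ... | yes e = proj₁ (σ x y e)
    ... | no _  = 0ᴹ

    transport : ∀ {t} → Fin n → Vec (Fin n) t → Matrix d d
    transport x []       = 1ᴹ
    transport x (y ∷ ys) = σ₀ x y ⊗ transport y ys

    OrthogonalOrZero : Matrix d d → Set
    OrthogonalOrZero A = IsOrthogonal A ⊎ A ≋ 0ᴹ

    σ₀-orthogonal : ∀ x y → OrthogonalOrZero (σ₀ x y)
    σ₀-orthogonal x y with 0# <? w x y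
    ... | yes e = inj₁ (proj₂ (σ x y e))
    ... | no _  = inj₂ (λ _ _ → refl)

    transport-orthogonal : ∀ {t} x (xs : Vec (Fin n) t) → OrthogonalOrZero (transport x xs)
    transport-orthogonal x [] = inj₁ (≋-trans (⊗-congʳ 1ᴹ (λ i j → 1ᴹ-symm j i)) (⊗-identityˡ 1ᴹ))
    transport-orthogonal x (y ∷ ys) with σ₀-orthogonal x y | transport-orthogonal y ys
    ... | inj₂ A≋0 | _        = inj₂ (λ i j → sum-zero (λ k → trans (*-congʳ (A≋0 i k)) (zeroˡ _)))
    ... | inj₁ _   | inj₂ B≋0 = inj₂ (λ i j → sum-zero (λ k → trans (*-congˡ (B≋0 k j)) (zeroʳ _)))
    ... | inj₁ p   | inj₁ q   = inj₁
      (≋-trans (⊗-congʳ (A ⊗ B) (⊗-ᵀ A B)) (≋-trans (⊗-assoc (B ᵀ) (A ᵀ) (A ⊗ B))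
      (≋-trans (⊗-congˡ (B ᵀ) (≋-trans (≋-sym (⊗-assoc (A ᵀ) A B))
        (≋-trans (⊗-congʳ B p) (⊗-identityˡ B)))) q)))
      where
      A = σ₀ x y
      B = transport y ys

    entry²≤1 : ∀ {A} → OrthogonalOrZero A → ∀ a b → A a b * A a b ≤ 1#
    entry²≤1 (inj₂ A≋0) a b = ≤-trans (≈⇒≤ (trans (*-congʳ (A≋0 a b)) (zeroˡ _))) (inj₁ 0<1)
    entry²≤1 {A} (inj₁ p) a b = begin
      A a b * A a b       ≤⟨ term≤sum (λ k → sq-nonneg (A k b)) a ⟩
      (A ᵀ ⊗ A) b b       ≈⟨ p b b ⟩
      1ᴹ b b              ≈⟨ 1ᴹ-diagonal b ⟩
      1#                  ∎
      where
      1ᴹ-diagonal : ∀ b → 1ᴹ {d} b b ≈ 1#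
      1ᴹ-diagonal b with b Fin.≟ b
      ... | yes _  = refl
      ... | no b≢b = ⊥-elim (b≢b ≡.refl)

    transport-entry : Fin d → Fin d → Functional n
    transport-entry a b x xs = transport x xs a b

    open Walk G

    expected-transport : ∀ j i a b → ∃ (IsHittingExpectation (transport-entry a b) j i)
    expected-transport j i a b = hittingExpectation (transport-entry a b)
      (λ x xs → sq≤1⇒≤1 (entry²≤1 (transport-orthogonal x xs) a b))
      (λ x xs → sq≤1⇒≤1 (≤-trans (≈⇒≤ (neg-sq _)) (entry²≤1 (transport-orthogonal x xs) a b)))
      j i

    abstract

      Ω⁰ : Fin n → Fin n → Matrix d d
      Ω⁰ i j a b = proj₁ (expected-transport j i a b)

      Ω⁰-isExpectation : ∀ i j a b → IsHittingExpectation (transport-entry a b) j i (Ω⁰ i j a b)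
      Ω⁰-isExpectation i j a b = proj₂ (expected-transport j i a b)

    𝓛 : Matrix (n ℕ.* d) (n ℕ.* d)
    𝓛 = fromBlocks λ x y →
      if does (x Fin.≟ y) then deg x ·ᴹ 1ᴹ else (- w x y) ·ᴹ σ₀ x y

    N : Fin n → Fin n → Matrix (n ℕ.* d) d
    N i j = fromBlockColumn λ x →
      if does (x Fin.≟ i) then 1ᴹ
      else if does (x Fin.≟ j) then -ᴹ (Ω⁰ i j ᵀ)
      else 0ᴹ

    𝓦 : Fin n → Fin n → Matrix (n ℕ.* d) d
    𝓦 i j = 𝓛 † ⊗ N i j

    resistance : Fin n → Fin n → ℝ
    resistance i j = 1# / ((2 ℕ.* d) ×ℝ 1#) *
      Tr (𝓦 i j ᵀ ⊗ 𝓛 ⊗ 𝓦 i j ⊕ 𝓦 j i ᵀ ⊗ 𝓛 ⊗ 𝓦 j i)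

  -- Entrywise distance less than δ over all edges: these balls are a basis of
  -- neighbourhoods for the product topology on O(d)^E.
  Close : ∀ {n d} {G : WeightedGraph n} → ℝ → Signature G d → Signature G d → Set
  Close {G = G} δ s τ = ∀ x y .(e : WeightedGraph.Edge G x y) a b →
    ∣ proj₁ (Signature.σ τ x y e) a b - proj₁ (Signature.σ s x y e) a b ∣ < δ

  Continuous : ∀ {n d} {G : WeightedGraph n} → (Signature G d → ℝ) → Set
  Continuous f = ∀ s ε → 0# < ε →
    ∃[ δ ] 0# < δ × (∀ τ → Close δ s τ → ∣ f τ - f s ∣ < ε)

{-# OPTIONS --safe #-}

-- The pseudoinverse 𝓛 † is not continuous in the signature, because the rank
-- of 𝓛 jumps.  The resistance only sees the walk grounded at j.  The matrix
-- Ω⁰ j-harmonically extends a vector at j, so subtracting Ω⁰ f(j) from a field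
-- f makes it vanish at j without changing 𝓛 f elsewhere; call this grounding.
-- On grounded fields the energy ⟨ f , 𝓛 f ⟩ = ½ ∑ w |f(x) − σ f(y)|² is
-- coercive, with a constant C that depends on the graph alone: orthogonal
-- transport preserves norms, so |f(x)|² is bounded along a path from x to j.
-- Hence a field in the kernel of 𝓛 is determined by its value at j, which puts
-- N i j in the range of 𝓛, and the diagonal entries of 𝓦ᵀ 𝓛 𝓦 are the values at
-- i of the grounded potentials X.  These are Green's functions, their entries
-- are at most C in absolute value, and for two signatures s and τ the values
-- at i differ by ⟨ X , (𝓛 s − 𝓛 τ) X′ ⟩.  So the resistance is Lipschitz.

module Submission where

import Algebra.Solver.Ring as RingSolver
open import Algebra.Solver.Ring.AlmostCommutativeRing
  using (_-Raw-AlmostCommutative⟶_; fromCommutativeRing)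
open import Data.Bool.Base using (true; false; if_then_else_)
open import Data.Empty using (⊥-elim)
open import Data.Fin.Base
  using (Fin; zero; suc; toℕ; combine; _↑ˡ_; _↑ʳ_; quotient; remainder)
import Data.Fin.Properties as Fin
open import Data.Integer.Base as ℤ using (ℤ; +_; -[1+_]; _⊖_; _◃_)
import Data.Integer.Properties as ℤ
open import Data.Maybe.Base using (Maybe; map)
open import Data.Nat.Base as ℕ using (ℕ; zero; suc; NonZero)
import Data.Nat.Properties as ℕ
open import Data.Product.Base using (∃-syntax; _×_; _,_; proj₁; proj₂)
import Data.Sign.Base as Sign
open import Data.Sum.Base using (_⊎_; inj₁; inj₂)
open import Data.Vec.Base using (Vec; _∷_)
open import Function.Base using (_∘_)
open import Relation.Binary.Construct.Closure.ReflexiveTransitive as Star using (Star; _◅_)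
open import Relation.Binary.Definitions using (tri<; tri≈; tri>)
open import Relation.Binary.PropositionalEquality.Core as ≡ using (_≡_; _≢_)
open import Relation.Nullary.Decidable.Core using (Dec; yes; no; does; dec⇒maybe)
open import Relation.Nullary.Negation.Core using (¬_)
open import Defs

-- A ring solver with integer coefficients.

module RingSolving (𝓡 : CompleteOrderedField) where

  open Real 𝓡

  module IntegerCoefficients where

    open import Algebra.Properties.Semiring.Mult semiring using (×-homo-+; ×1-homo-*)

    -- Equality in `ℝ` is decided by a field of the abstract model and does not compute, so normal
    -- forms take their coefficients from `ℤ`, where cancellation is by evaluation.
    embed : ℤ → ℝ
    embed (+ n)    = n ×ℝ 1#
    embed -[1+ n ] = - (suc n ×ℝ 1#)

    embed-⊖ : ∀ m n → embed (m ⊖ n) ≈ m ×ℝ 1# - n ×ℝ 1#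
    embed-⊖ m       zero    = sym (trans (+-congˡ -0#≈0#) (+-identityʳ _))
    embed-⊖ zero    (suc n) = sym (+-identityˡ _)
    embed-⊖ (suc m) (suc n) rewrite ℤ.[1+m]⊖[1+n]≡m⊖n m n = begin-equality
      embed (m ⊖ n)                               ≈⟨ embed-⊖ m n ⟩
      m ×ℝ 1# - n ×ℝ 1#                           ≈⟨ +-identityˡ _ ⟨
      0# + (m ×ℝ 1# - n ×ℝ 1#)                    ≈⟨ +-congʳ (-‿inverseʳ 1#) ⟨
      (1# - 1#) + (m ×ℝ 1# - n ×ℝ 1#)             ≈⟨ +-swap _ _ _ _ ⟩
      (1# + m ×ℝ 1#) + (- 1# - n ×ℝ 1#)           ≈⟨ +-congˡ (-‿+-comm 1# (n ×ℝ 1#)) ⟩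
      (1# + m ×ℝ 1#) - (1# + n ×ℝ 1#)             ∎

    embed-+ : ∀ x y → embed (x ℤ.+ y) ≈ embed x + embed y
    embed-+ (+ m)    (+ n)    = ×-homo-+ 1# m n
    embed-+ (+ m)    -[1+ n ] = embed-⊖ m (suc n)
    embed-+ -[1+ m ] (+ n)    = trans (embed-⊖ n (suc m)) (+-comm _ _)
    embed-+ -[1+ m ] -[1+ n ] = begin-equality
      - (suc (suc (m ℕ.+ n)) ×ℝ 1#)       ≡⟨ ≡.cong (λ k → - (k ×ℝ 1#)) (≡.sym (ℕ.+-suc (suc m) n)) ⟩
      - ((suc m ℕ.+ suc n) ×ℝ 1#)         ≈⟨ -‿cong (×-homo-+ 1# (suc m) (suc n)) ⟩
      - (suc m ×ℝ 1# + suc n ×ℝ 1#)       ≈⟨ -‿+-comm _ _ ⟨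
      - (suc m ×ℝ 1#) - suc n ×ℝ 1#       ∎

    embed-◃⁻ : ∀ n → embed (Sign.- ◃ n) ≈ - (n ×ℝ 1#)
    embed-◃⁻ zero    = sym -0#≈0#
    embed-◃⁻ (suc n) = refl

    embed-◃⁺ : ∀ n → embed (Sign.+ ◃ n) ≈ n ×ℝ 1#
    embed-◃⁺ zero    = refl
    embed-◃⁺ (suc n) = refl

    embed-* : ∀ x y → embed (x ℤ.* y) ≈ embed x * embed y
    embed-* (+ m)    (+ n)    = trans (embed-◃⁺ (m ℕ.* n)) (×1-homo-* m n)
    embed-* (+ m)    -[1+ n ] = begin-equality
      embed (Sign.- ◃ m ℕ.* suc n)        ≈⟨ embed-◃⁻ (m ℕ.* suc n) ⟩
      - ((m ℕ.* suc n) ×ℝ 1#)             ≈⟨ -‿cong (×1-homo-* m (suc n)) ⟩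
      - (m ×ℝ 1# * (suc n ×ℝ 1#))         ≈⟨ -‿distribʳ-* _ _ ⟩
      m ×ℝ 1# * - (suc n ×ℝ 1#)           ∎
    embed-* -[1+ m ] (+ n)    = begin-equality
      embed (Sign.- ◃ suc m ℕ.* n)        ≈⟨ embed-◃⁻ (suc m ℕ.* n) ⟩
      - ((suc m ℕ.* n) ×ℝ 1#)             ≈⟨ -‿cong (×1-homo-* (suc m) n) ⟩
      - (suc m ×ℝ 1# * (n ×ℝ 1#))         ≈⟨ -‿distribˡ-* _ _ ⟩
      - (suc m ×ℝ 1#) * (n ×ℝ 1#)         ∎
    embed-* -[1+ m ] -[1+ n ] = begin-equality
      (suc m ℕ.* suc n) ×ℝ 1#             ≈⟨ ×1-homo-* (suc m) (suc n) ⟩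
      M * N                               ≈⟨ neg-involutive (M * N) ⟨
      - - (M * N)                         ≈⟨ -‿cong (-‿distribʳ-* M N) ⟩
      - (M * - N)                         ≈⟨ -‿distribˡ-* M (- N) ⟩
      - M * - N                           ∎
      where
      M N : ℝ
      M = suc m ×ℝ 1#
      N = suc n ×ℝ 1#

    embed-neg : ∀ x → embed (ℤ.- x) ≈ - embed x
    embed-neg (+ zero)  = sym -0#≈0#
    embed-neg (+ suc n) = refl
    embed-neg -[1+ n ]  = sym (neg-involutive _)

    homomorphism : ℤ.+-*-rawRing -Raw-AlmostCommutative⟶ fromCommutativeRing commutativeRing
    homomorphism = record
      { ⟦_⟧    = embed
      ; +-homo = embed-+
      ; *-homo = embed-*
      ; -‿homo = embed-neg
      ; 0-homo = refl
      ; 1-homo = +-identityʳ 1#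
      }

    _≟ᶜ_ : ∀ x y → Maybe (embed x ≈ embed y)
    x ≟ᶜ y = map (λ { ≡.refl → refl }) (dec⇒maybe (x ℤ.≟ y))

  open RingSolver ℤ.+-*-rawRing (fromCommutativeRing commutativeRing)
    IntegerCoefficients.homomorphism IntegerCoefficients._≟ᶜ_
    public
    using (solve; _:=_; _:+_; _:*_; _:-_; :-_)

-- Order estimates, null sequences and finite sums.

module Analysis (𝓡 : CompleteOrderedField) where

  open Real 𝓡
  open RingSolving 𝓡

  *-monoˡ-≤ : ∀ {x y z} → 0# ≤ x → y ≤ z → y * x ≤ z * x
  *-monoˡ-≤ {x} {y} {z} 0≤x y≤z = begin
    y * x ≈⟨ *-comm y x ⟩
    x * y ≤⟨ *-monoʳ-≤ 0≤x y≤z ⟩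
    x * z ≈⟨ *-comm x z ⟩
    z * x ∎

  neg-anti-≤ : ∀ {x y} → x ≤ y → - y ≤ - x
  neg-anti-≤ (inj₁ x<y) = inj₁ (neg-anti-< x<y)
  neg-anti-≤ (inj₂ x≈y) = inj₂ (-‿cong (sym x≈y))

  *-cancelˡ-≤ : ∀ {x y z} → 0# < x → x * y ≤ x * z → y ≤ z
  *-cancelˡ-≤ {x} {y} {z} 0<x xy≤xz with compare y z
  ... | tri< y<z _ _ = inj₁ y<z
  ... | tri≈ _ y≈z _ = inj₂ y≈z
  ... | tri> _ _ z<y = ⊥-elim (<-irrefl refl (begin-strict
    0#              <⟨ *-pos 0<x (<-respˡ-≈ (-‿inverseʳ z) (+-monoˡ-< (- z) z<y)) ⟩
    x * (y - z)     ≈⟨ solve 3 (λ x y z → x :* (y :- z) := x :* y :- x :* z) refl x y z ⟩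
    x * y - x * z   ≤⟨ +-monoˡ-≤ _ xy≤xz ⟩
    x * z - x * z   ≈⟨ -‿inverseʳ _ ⟩
    0#              ∎))

  ≤-or-≤ : ∀ x → 0# ≤ x ⊎ 0# ≤ - x
  ≤-or-≤ x with compare x 0#
  ... | tri< x<0 _ _ = inj₂ (inj₁ (x<0⇒0<-x x<0))
  ... | tri≈ _ x≈0 _ = inj₁ (inj₂ (sym x≈0))
  ... | tri> _ _ 0<x = inj₁ (inj₁ 0<x)

  -- Turns a quadratic self-estimate into a linear one: a positive `x` is cancelled, and any other
  -- `x` lies below 0 ≤ `B`.
  x²≤Bx⇒x≤B : ∀ {B x} → 0# ≤ B → x * x ≤ B * x → x ≤ B
  x²≤Bx⇒x≤B {B} {x} 0≤B x²≤Bx with compare 0# x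
  ... | tri< 0<x _ _ = *-cancelˡ-≤ 0<x (≤-trans x²≤Bx (≈⇒≤ (*-comm B x)))
  ... | tri≈ _ 0≈x _ = ≤-trans (≈⇒≤ (sym 0≈x)) 0≤B
  ... | tri> _ _ x<0 = ≤-trans (inj₁ x<0) 0≤B

  -- Stands for ∣ x ∣ ≤ B; the pair of inequalities avoids the case split inside `∣_∣`.
  Bounded : ℝ → ℝ → Set
  Bounded B x = x ≤ B × - x ≤ B

  bounded-resp-≈ : ∀ {B x y} → x ≈ y → Bounded B x → Bounded B y
  bounded-resp-≈ x≈y (p , q) = ≤-trans (≈⇒≤ (sym x≈y)) p , ≤-trans (≈⇒≤ (-‿cong (sym x≈y))) q

  bounded-weaken : ∀ {B C x} → B ≤ C → Bounded B x → Bounded C x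
  bounded-weaken B≤C (p , q) = ≤-trans p B≤C , ≤-trans q B≤C

  bounded-zero : ∀ {B x} → 0# ≤ B → x ≈ 0# → Bounded B x
  bounded-zero 0≤B x≈0 = bounded-resp-≈ (sym x≈0) (0≤B , ≤-trans (≈⇒≤ -0#≈0#) 0≤B)

  bounded-neg : ∀ {B x} → Bounded B x → Bounded B (- x)
  bounded-neg (p , q) = q , ≤-trans (≈⇒≤ (neg-involutive _)) p

  bounded-nonneg : ∀ {B x} → 0# ≤ x → x ≤ B → Bounded B x
  bounded-nonneg {B} {x} 0≤x x≤B = x≤B , (begin
    - x  ≤⟨ neg-anti-≤ 0≤x ⟩
    - 0# ≈⟨ -0#≈0# ⟩
    0#   ≤⟨ 0≤x ⟩
    x    ≤⟨ x≤B ⟩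
    B    ∎)

  bounded-+ : ∀ {B C x y} → Bounded B x → Bounded C y → Bounded (B + C) (x + y)
  bounded-+ (p , q) (r , s) = +-mono-≤ p r , ≤-trans (≈⇒≤ (sym (-‿+-comm _ _))) (+-mono-≤ q s)

  bounded-sum : ∀ {n} {B f : Fin n → ℝ} → (∀ k → Bounded (B k) (f k)) → Bounded (sum B) (sum f)
  bounded-sum {zero}  p = bounded-zero (≈⇒≤ refl) refl
  bounded-sum {suc n} p = bounded-+ (p zero) (bounded-sum (p ∘ suc))

  -- Replacing `y` by its negative if necessary makes it nonnegative; then ∣ x ∣ y ≤ B y ≤ B C.
  bounded-* : ∀ {B C x y} → 0# ≤ B → Bounded B x → Bounded C y → Bounded (B * C) (x * y)
  bounded-* {B} {C} {x} {y} 0≤B x-bounded y-bounded = by-sign (≤-or-≤ y)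
    where
    pos : ∀ {y} → 0# ≤ y → Bounded C y → Bounded (B * C) (x * y)
    pos {y} 0≤y (y≤C , _) =
      ≤-trans (*-monoˡ-≤ 0≤y (proj₁ x-bounded)) By≤BC ,
      ≤-trans (≈⇒≤ (-‿distribˡ-* x y)) (≤-trans (*-monoˡ-≤ 0≤y (proj₂ x-bounded)) By≤BC)
      where
      By≤BC = *-monoʳ-≤ 0≤B y≤C

    by-sign : 0# ≤ y ⊎ 0# ≤ - y → Bounded (B * C) (x * y)
    by-sign (inj₁ 0≤y)  = pos 0≤y y-bounded
    by-sign (inj₂ 0≤-y) = bounded-resp-≈
      (solve 2 (λ x y → :- (x :* :- y) := x :* y) refl x y)
      (bounded-neg (pos 0≤-y (bounded-neg y-bounded)))

  sq≤sq⇒bounded : ∀ {B x} → 0# ≤ B → x * x ≤ B * B → Bounded B x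
  sq≤sq⇒bounded {B} {x} 0≤B x²≤B² = upper x²≤B² , upper (≤-trans (≈⇒≤ (neg-sq x)) x²≤B²)
    where
    upper : ∀ {y} → y * y ≤ B * B → y ≤ B
    upper {y} y²≤B² with compare y B
    ... | tri< y<B _ _ = inj₁ y<B
    ... | tri≈ _ y≈B _ = inj₂ y≈B
    ... | tri> _ _ B<y = x²≤Bx⇒x≤B 0≤B (≤-trans y²≤B² (*-monoʳ-≤ 0≤B (inj₁ B<y)))

  -- A bound for ∣ x ∣ that is strictly positive for every `x`, hence usable as a divisor.
  bounded-by-sq : ∀ x → Bounded (1# + x * x) x
  bounded-by-sq x = sq≤sq⇒bounded (0≤+ (inj₁ 0<1) (sq-nonneg x)) (begin
    x * x                                 ≈⟨ +-identityʳ _ ⟨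
    -- With y = x², the square (1 + y)² exceeds y by 1 + y + y², a sum of three squares.
    x * x + 0#                            ≤⟨ +-monoʳ-≤ _ (0≤+ (sq-nonneg 1#) (0≤+ (sq-nonneg x) (sq-nonneg (x * x)))) ⟩
    x * x + (1# * 1# + (x * x + x * x * (x * x)))
      ≈⟨ +-congˡ (+-congˡ (+-congʳ (*-identityˡ _))) ⟨
    x * x + (1# * 1# + (1# * (x * x) + x * x * (x * x)))
      ≈⟨ +-congʳ (*-identityˡ _) ⟨
    1# * (x * x) + (1# * 1# + (1# * (x * x) + x * x * (x * x)))
      ≈⟨ solve 2 (λ o y → o :* y :+ (o :* o :+ (o :* y :+ y :* y)) := (o :+ y) :* (o :+ y)) refl 1# (x * x) ⟩
    (1# + x * x) * (1# + x * x)           ∎)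

  *-/-cancel : ∀ x {y} → 0# < y → y * (x / y) ≈ x
  *-/-cancel x {y} 0<y = begin-equality
    y * (x * y ⁻¹)   ≈⟨ solve 3 (λ x y i → y :* (x :* i) := y :* i :* x) refl x y (y ⁻¹) ⟩
    y * y ⁻¹ * x     ≈⟨ *-congʳ (*-⁻¹ (pos⇒≉0 0<y)) ⟩
    1# * x           ≈⟨ *-identityˡ x ⟩
    x                ∎

  -- Limits are treated as remainders tending to 0, so that linear relations pass to the limit by
  -- closure rules. The bound is nonstrict to match `Bounded`; as ε is arbitrary, the notion is the
  -- same.
  Null : (ℕ → ℝ) → Set
  Null u = ∀ ε → 0# < ε → ∃[ N ] ∀ m → N ℕ.≤ m → Bounded ε (u m)

  null-resp-≈ : ∀ {u v} → (∀ m → u m ≈ v m) → Null u → Null v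
  null-resp-≈ u≈v u⟶0 ε 0<ε with u⟶0 ε 0<ε
  ... | N , bound = N , λ m N≤m → bounded-resp-≈ (u≈v m) (bound m N≤m)

  null-+ : ∀ {u v} → Null u → Null v → Null (λ m → u m + v m)
  null-+ u⟶0 v⟶0 ε 0<ε with half ε 0<ε
  ... | h , 0<h , h+h≈ε with u⟶0 h 0<h | v⟶0 h 0<h
  ... | M , u-bound | N , v-bound = M ℕ.⊔ N , λ m M⊔N≤m → bounded-weaken (≈⇒≤ h+h≈ε) (bounded-+
    (u-bound m (ℕ.≤-trans (ℕ.m≤m⊔n M N) M⊔N≤m))
    (v-bound m (ℕ.≤-trans (ℕ.m≤n⊔m M N) M⊔N≤m)))

  null-sum : ∀ {n} {u : Fin n → ℕ → ℝ} → (∀ k → Null (u k)) → Null (λ m → ∑[ k < n ] u k m)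
  null-sum {zero}  _   ε 0<ε = 0 , λ _ _ → bounded-zero (inj₁ 0<ε) refl
  null-sum {suc n} u⟶0       = null-+ (u⟶0 zero) (null-sum (u⟶0 ∘ suc))

  0<1+sq : ∀ c → 0# < 1# + c * c
  0<1+sq c = <-≤-trans 0<1 (≤-trans (≈⇒≤ (sym (+-identityʳ 1#))) (+-monoʳ-≤ 1# (sq-nonneg c)))

  null-* : ∀ {u} c → Null u → Null (λ m → c * u m)
  null-* {u} c u⟶0 ε 0<ε with u⟶0 (ε / (1# + c * c)) (*-pos 0<ε (⁻¹-pos (0<1+sq c)))
  ... | N , bound = N , λ m N≤m → bounded-weaken (≈⇒≤ (*-/-cancel ε (0<1+sq c)))
                          (bounded-* (inj₁ (0<1+sq c)) (bounded-by-sq c) (bound m N≤m))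

  null-neg : ∀ {u} → Null u → Null (λ m → - u m)
  null-neg u⟶0 ε 0<ε with u⟶0 ε 0<ε
  ... | N , bound = N , λ m N≤m → bounded-neg (bound m N≤m)

  null-tail : ∀ {u} → Null u → Null (u ∘ suc)
  null-tail u⟶0 ε 0<ε with u⟶0 ε 0<ε
  ... | N , bound = N , λ m N≤m → bound (suc m) (ℕ.m≤n⇒m≤1+n N≤m)

  null-constant-≯0 : ∀ {x} → Null (λ _ → x) → ¬ 0# < x
  null-constant-≯0 {x} x⟶0 0<x with half x 0<x
  ... | h , 0<h , h+h≈x with x⟶0 h 0<h
  ... | N , bound = <-irrefl refl (begin-strict
    x      ≤⟨ proj₁ (bound N ℕ.≤-refl) ⟩
    h      ≈⟨ +-identityʳ h ⟨
    h + 0# <⟨ +-monoʳ-< h 0<h ⟩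
    h + h  ≈⟨ h+h≈x ⟩
    x      ∎)

  -- Identities between limits are proved by this: the difference of the two sides is a constant
  -- sequence assembled from null remainders.
  null-constant : ∀ {x} → Null (λ _ → x) → x ≈ 0#
  null-constant {x} x⟶0 with compare 0# x
  ... | tri< 0<x _ _ = ⊥-elim (null-constant-≯0 x⟶0 0<x)
  ... | tri≈ _ 0≈x _ = sym 0≈x
  ... | tri> _ _ x<0 = ⊥-elim (null-constant-≯0 (null-neg x⟶0) (x<0⇒0<-x x<0))

  ⟶⇒null : ∀ {s l} → s ⟶ l → Null (λ m → s m - l)
  ⟶⇒null s⟶l ε 0<ε with s⟶l ε 0<ε
  ... | N , close = N , λ m N≤m →
    let p , q = ∣∣<-elim (close m N≤m) in inj₁ p , inj₁ q

  x-y≈0⇒x≈y : ∀ {x y} → x - y ≈ 0# → x ≈ y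
  x-y≈0⇒x≈y {x} {y} p = trans (sym (+-cancel-neg x y)) (trans (+-congʳ p) (+-identityˡ y))

  sum-distrib-sub : ∀ {n} (f g : Fin n → ℝ) → ∑[ k < n ] (f k - g k) ≈ sum f - sum g
  sum-distrib-sub {zero}  f g = sym (-‿inverseʳ 0#)
  sum-distrib-sub {suc n} f g = trans (+-congˡ (sum-distrib-sub (f ∘ suc) (g ∘ suc)))
    (solve 4 (λ a b c d → (a :- b) :+ (c :- d) := (a :+ c) :- (b :+ d)) refl
      (f zero) (g zero) (sum (f ∘ suc)) (sum (g ∘ suc)))

  sum-nested-cong : ∀ {m n} {f g : Fin m → Fin n → ℝ} → (∀ x y → f x y ≈ g x y) →
                    ∑[ x < m ] ∑[ y < n ] f x y ≈ ∑[ x < m ] ∑[ y < n ] g x y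
  sum-nested-cong p = sum-cong-≋ (λ x → sum-cong-≋ (p x))

  sum-↑ : ∀ m {n} (f : Fin (m ℕ.+ n) → ℝ) →
          sum f ≈ ∑[ k < m ] f (k ↑ˡ n) + ∑[ k < n ] f (m ↑ʳ k)
  sum-↑ zero    f = sym (+-identityˡ _)
  sum-↑ (suc m) f = trans (+-congˡ (sum-↑ m (f ∘ suc))) (sym (+-assoc _ _ _))

  sum-combine : ∀ n {d} (f : Fin (n ℕ.* d) → ℝ) →
                sum f ≈ ∑[ x < n ] ∑[ a < d ] f (combine x a)
  sum-combine zero        f = refl
  sum-combine (suc n) {d} f = trans (sum-↑ d f) (+-congˡ (sum-combine n (λ r → f (d ↑ʳ r))))

-- The energy form of the connection Laplacian and its coercivity.

module Energy (𝓡 : CompleteOrderedField) where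

  open Real 𝓡
  open RingSolving 𝓡
  open Analysis 𝓡

  infixl 7 _·_

  _·_ : ∀ {m n} → Matrix m n → (Fin n → ℝ) → Fin m → ℝ
  (A · v) i = ⟨ A i , v ⟩

  ⟨⟩-congˡ : ∀ {n} (x : Fin n → ℝ) {y z : Fin n → ℝ} → (∀ k → y k ≈ z k) → ⟨ x , y ⟩ ≈ ⟨ x , z ⟩
  ⟨⟩-congˡ x p = sum-cong-≋ (λ k → *-congˡ (p k))

  ⟨⟩-congʳ : ∀ {n} {x y : Fin n → ℝ} (z : Fin n → ℝ) → (∀ k → x k ≈ y k) → ⟨ x , z ⟩ ≈ ⟨ y , z ⟩
  ⟨⟩-congʳ z p = sum-cong-≋ (λ k → *-congʳ (p k))

  ⟨⟩-nonneg : ∀ {n} (v : Fin n → ℝ) → 0# ≤ ⟨ v , v ⟩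
  ⟨⟩-nonneg v = sum-nonneg (λ k → sq-nonneg (v k))

  ·-isometry : ∀ {d} {A : Matrix d d} → IsOrthogonal A → ∀ v → ⟨ A · v , A · v ⟩ ≈ ⟨ v , v ⟩
  ·-isometry {d} {A} AᵀA≋1 v = ≋-trans (⊗-congʳ (A ⊗ V) (⊗-ᵀ A V))
    (≋-trans (⊗-assoc (V ᵀ) (A ᵀ) (A ⊗ V))
    (⊗-congˡ (V ᵀ) (≋-trans (≋-sym (⊗-assoc (A ᵀ) A V))
      (≋-trans (⊗-congʳ V AᵀA≋1) (⊗-identityˡ V))))) zero zero
    where
    -- A one-column matrix, so that associativity of `⊗` applies to the vector.
    V : Matrix d 1
    V k _ = v k

  -- In each coordinate the right side exceeds the left by the square (a - 2b)².
  ⟨⟩-≤-double : ∀ {n} (x y : Fin n → ℝ) → let z = λ k → x k - y k in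
    ⟨ x , x ⟩ ≤ (⟨ z , z ⟩ + ⟨ z , z ⟩) + (⟨ y , y ⟩ + ⟨ y , y ⟩)
  ⟨⟩-≤-double {n} x y = begin
    ⟨ x , x ⟩
      ≤⟨ sum-mono-≤ (λ k → pointwise (x k) (y k)) ⟩
    ∑[ k < n ] ((z k * z k + z k * z k) + (y k * y k + y k * y k))
      ≈⟨ ∑-distrib-+ {n} _ _ ⟩
    ∑[ k < n ] (z k * z k + z k * z k) + ∑[ k < n ] (y k * y k + y k * y k)
      ≈⟨ +-cong (∑-distrib-+ {n} _ _) (∑-distrib-+ {n} _ _) ⟩
    (⟨ z , z ⟩ + ⟨ z , z ⟩) + (⟨ y , y ⟩ + ⟨ y , y ⟩) ∎
    where
    z : Fin n → ℝ
    z k = x k - y k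
    pointwise : ∀ a b → a * a ≤ ((a - b) * (a - b) + (a - b) * (a - b)) + (b * b + b * b)
    pointwise a b = 0≤-⇒≤ (≤-trans (sq-nonneg (a - (b + b))) (≈⇒≤ (solve 2
      (λ a b → (a :- (b :+ b)) :* (a :- (b :+ b)) :=
               ((a :- b) :* (a :- b) :+ (a :- b) :* (a :- b)) :+ (b :* b :+ b :* b) :- a :* a)
      refl a b)))

  fromBlocks-combine : ∀ {n m d e} (B : Fin n → Fin m → Matrix d e) x a y b →
                       fromBlocks B (combine x a) (combine y b) ≡ B x y a b
  fromBlocks-combine B x a y b =
    ≡.cong₂ (λ p q → B (proj₁ p) (proj₁ q) (proj₂ p) (proj₂ q))
      (Fin.remQuot-combine x a) (Fin.remQuot-combine y b)

  fromBlockColumn-combine : ∀ {n d e} (B : Fin n → Matrix d e) x a c →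
                            fromBlockColumn B (combine x a) c ≡ B x a c
  fromBlockColumn-combine B x a c =
    ≡.cong (λ p → B (proj₁ p) (proj₂ p) c) (Fin.remQuot-combine x a)

  module OnGraph {n : ℕ} (G : WeightedGraph n) (d : ℕ) where

    open WeightedGraph G

    at : (Fin (n ℕ.* d) → ℝ) → Fin n → Fin d → ℝ
    at f x a = f (combine x a)

    module _ (s : Signature G d) where

      open Signature s

      σ₀-ᵀ : ∀ x y → σ₀ y x ≋ σ₀ x y ᵀ
      σ₀-ᵀ x y with 0# <? w x y | 0# <? w y x
      ... | yes e | yes e′ = σ-symm x y e e′
      ... | no _  | no _   = λ _ _ → refl
      ... | yes e | no ¬e  = ⊥-elim (¬e (<-respʳ-≈ (w-symm x y) e))
      ... | no ¬e | yes e  = ⊥-elim (¬e (<-respʳ-≈ (w-symm y x) e))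

      σ₀-edge : ∀ {x y} (e : Edge x y) → σ₀ x y ≋ proj₁ (σ x y e)
      σ₀-edge {x} {y} e with 0# <? w x y
      ... | yes _ = λ _ _ → refl
      ... | no ¬e = ⊥-elim (¬e e)

      σ₀-nonedge : ∀ {x y} → ¬ Edge x y → σ₀ x y ≋ 0ᴹ
      σ₀-nonedge {x} {y} ¬e with 0# <? w x y
      ... | yes e = ⊥-elim (¬e e)
      ... | no _  = λ _ _ → refl

      -- Kronecker deltas replace the case distinction, with indices ordered so that `sum-1ᴹ`
      -- evaluates the block sums. On the diagonal the second term vanishes because the graph has no
      -- loops.
      𝓛-block : ∀ x a y b → 𝓛 (combine x a) (combine y b) ≈
                deg x * 1ᴹ b a * 1ᴹ y x - w x y * σ₀ x y a b
      𝓛-block x a y b = trans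
        (reflexive (fromBlocks-combine
          (λ x y → if does (x Fin.≟ y) then deg x ·ᴹ 1ᴹ else (- w x y) ·ᴹ σ₀ x y) x a y b))
        block
        where
        block : (if does (x Fin.≟ y) then deg x ·ᴹ 1ᴹ else (- w x y) ·ᴹ σ₀ x y) a b ≈
                deg x * 1ᴹ b a * 1ᴹ y x - w x y * σ₀ x y a b
        block with x Fin.≟ y | y Fin.≟ x
        ... | yes ≡.refl | yes _ = begin-equality
          deg x * 1ᴹ a b
            ≈⟨ *-congˡ (1ᴹ-symm a b) ⟩
          deg x * 1ᴹ b a
            ≈⟨ *-identityʳ _ ⟨
          deg x * 1ᴹ b a * 1#
            -- The solver receives `0#` as a variable, so it can only insert a difference z - z.
            ≈⟨ solve 2 (λ x z → x := x :- (z :- z)) refl _ 0# ⟩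
          deg x * 1ᴹ b a * 1# - (0# - 0#)
            ≈⟨ +-congˡ (-‿cong (-‿inverseʳ 0#)) ⟩
          deg x * 1ᴹ b a * 1# - 0#
            ≈⟨ +-congˡ (-‿cong (trans (*-congʳ (w-loopless x)) (zeroˡ _))) ⟨
          deg x * 1ᴹ b a * 1# - w x x * σ₀ x x a b ∎
        ... | no _ | no _ = begin-equality
          - w x y * σ₀ x y a b
            ≈⟨ -‿distribˡ-* _ _ ⟨
          - (w x y * σ₀ x y a b)
            ≈⟨ +-identityˡ _ ⟨
          0# - w x y * σ₀ x y a b
            ≈⟨ +-congʳ (zeroʳ _) ⟨
          deg x * 1ᴹ b a * 0# - w x y * σ₀ x y a b ∎
        ... | yes p | no q  = ⊥-elim (q (≡.sym p))
        ... | no q  | yes p = ⊥-elim (q (≡.sym p))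

      𝓛-· : ∀ f x a → (𝓛 · f) (combine x a) ≈
            deg x * at f x a - ∑[ y < n ] (w x y * (σ₀ x y · at f y) a)
      𝓛-· f x a = begin-equality
        (𝓛 · f) (combine x a)
          ≈⟨ sum-combine n (λ r → 𝓛 (combine x a) r * f r) ⟩
        ∑[ y < n ] ∑[ b < d ] (𝓛 (combine x a) (combine y b) * at f y b)
          ≈⟨ sum-nested-cong (λ y b → trans (*-congʳ (𝓛-block x a y b)) (rearrange y b)) ⟩
        ∑[ y < n ] ∑[ b < d ] (deg x * 1ᴹ y x * (at f y b * 1ᴹ b a) - w x y * (σ₀ x y a b * at f y b))
          ≈⟨ sum-cong-≋ {n} (λ y → sum-distrib-sub {d} _ _) ⟩
        ∑[ y < n ] (∑[ b < d ] (deg x * 1ᴹ y x * (at f y b * 1ᴹ b a)) -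
                    ∑[ b < d ] (w x y * (σ₀ x y a b * at f y b)))
          ≈⟨ sum-cong-≋ (λ y → +-cong (diagonal y) (-‿cong (sym (*-distribˡ-sum {d} _ _)))) ⟩
        ∑[ y < n ] (deg x * at f y a * 1ᴹ y x - w x y * (σ₀ x y · at f y) a)
          ≈⟨ sum-distrib-sub {n} _ _ ⟩
        ∑[ y < n ] (deg x * at f y a * 1ᴹ y x) - ∑[ y < n ] (w x y * (σ₀ x y · at f y) a)
          ≈⟨ +-congʳ (sum-1ᴹ (λ y → deg x * at f y a) x) ⟩
        deg x * at f x a - ∑[ y < n ] (w x y * (σ₀ x y · at f y) a) ∎
        where
        rearrange : ∀ y b →
          (deg x * 1ᴹ b a * 1ᴹ y x - w x y * σ₀ x y a b) * at f y b ≈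
          deg x * 1ᴹ y x * (at f y b * 1ᴹ b a) - w x y * (σ₀ x y a b * at f y b)
        rearrange y b = solve 6 (λ D p q w σ f →
          (D :* p :* q :- w :* σ) :* f := D :* q :* (f :* p) :- w :* (σ :* f)) refl
          (deg x) (1ᴹ b a) (1ᴹ y x) (w x y) (σ₀ x y a b) (at f y b)
        diagonal : ∀ y → ∑[ b < d ] (deg x * 1ᴹ y x * (at f y b * 1ᴹ b a)) ≈ deg x * at f y a * 1ᴹ y x
        diagonal y = begin-equality
          ∑[ b < d ] (deg x * 1ᴹ y x * (at f y b * 1ᴹ b a)) ≈⟨ *-distribˡ-sum {d} _ _ ⟨
          deg x * 1ᴹ y x * ∑[ b < d ] (at f y b * 1ᴹ b a)   ≈⟨ *-congˡ (sum-1ᴹ (at f y) a) ⟩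
          deg x * 1ᴹ y x * at f y a
            ≈⟨ solve 3 (λ D p f → D :* p :* f := D :* f :* p) refl _ _ _ ⟩
          deg x * at f y a * 1ᴹ y x ∎

      𝓔 : (g f : Fin (n ℕ.* d) → ℝ) → ℝ
      𝓔 g f = ⟨ g , 𝓛 · f ⟩

      -- The covariant difference along an edge: the value at `y` is transported to `x` before
      -- subtraction.
      difference : (Fin (n ℕ.* d) → ℝ) → Fin n → Fin n → Fin d → ℝ
      difference f x y a = at f x a - (σ₀ x y · at f y) a

      -- On a nonedge `σ₀` is zero and not an isometry, but there the weight vanishes as well. With
      -- the weight as a factor, the identity holds for all pairs.
      w-isometry : ∀ x y v → w x y * ⟨ σ₀ x y · v , σ₀ x y · v ⟩ ≈ w x y * ⟨ v , v ⟩
      w-isometry x y v with 0# <? w x y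
      ... | yes e = *-congˡ (·-isometry (proj₂ (σ x y e)) v)
      ... | no ¬e with w-nonneg x y
      ...   | inj₁ e   = ⊥-elim (¬e e)
      ...   | inj₂ 0≈w = trans (trans (*-congʳ (sym 0≈w)) (zeroˡ _))
                           (sym (trans (*-congʳ (sym 0≈w)) (zeroˡ _)))

      -- The sum runs over ordered pairs and counts each edge in both orientations, hence twice the
      -- energy. Expanding the squares, `w-isometry` and the symmetry of `w` make both pure terms
      -- equal to the degree term `D`, while the mixed terms give -2 `M`.
      𝓔-sum-of-squares : ∀ f →
        ∑[ x < n ] ∑[ y < n ] (w x y * ⟨ difference f x y , difference f x y ⟩) ≈ 𝓔 f f + 𝓔 f f
      𝓔-sum-of-squares f = trans expand (trans
        (solve 2 (λ D M → D :- (M :+ M) :+ D := (D :- M) :+ (D :- M)) refl D M)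
        (+-cong (sym 𝓔≈D-M) (sym 𝓔≈D-M)))
        where
        u : Fin n → ℝ
        u x = ⟨ at f x , at f x ⟩
        m : Fin n → Fin n → ℝ
        m x y = ⟨ at f x , σ₀ x y · at f y ⟩
        D M : ℝ
        D = ∑[ x < n ] (deg x * u x)
        M = ∑[ x < n ] ∑[ y < n ] (w x y * m x y)

        𝓔≈D-M : 𝓔 f f ≈ D - M
        𝓔≈D-M = begin-equality
          𝓔 f f
            ≈⟨ sum-combine n (λ r → f r * (𝓛 · f) r) ⟩
          ∑[ x < n ] ∑[ a < d ] (at f x a * (𝓛 · f) (combine x a))
            ≈⟨ sum-nested-cong (λ x a → trans (*-congˡ (𝓛-· f x a))
                 (solve 3 (λ p D S → p :* (D :* p :- S) := D :* (p :* p) :- p :* S) refl _ _ _)) ⟩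
          ∑[ x < n ] ∑[ a < d ] (deg x * (at f x a * at f x a) -
                                 at f x a * ∑[ y < n ] (w x y * (σ₀ x y · at f y) a))
            ≈⟨ sum-cong-≋ (λ x → trans (sum-distrib-sub {d} _ _)
                 (+-cong (sym (*-distribˡ-sum {d} _ _)) (-‿cong (coupling x)))) ⟩
          ∑[ x < n ] (deg x * u x - ∑[ y < n ] (w x y * m x y))
            ≈⟨ sum-distrib-sub {n} _ _ ⟩
          D - M ∎
          where
          coupling : ∀ x → ∑[ a < d ] (at f x a * ∑[ y < n ] (w x y * (σ₀ x y · at f y) a)) ≈
                           ∑[ y < n ] (w x y * m x y)
          coupling x = begin-equality
            ∑[ a < d ] (at f x a * ∑[ y < n ] (w x y * (σ₀ x y · at f y) a))
              ≈⟨ sum-cong-≋ {d} (λ a → *-distribˡ-sum {n} _ _) ⟩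
            ∑[ a < d ] ∑[ y < n ] (at f x a * (w x y * (σ₀ x y · at f y) a))
              ≈⟨ ∑-comm {d} {n} _ ⟩
            ∑[ y < n ] ∑[ a < d ] (at f x a * (w x y * (σ₀ x y · at f y) a))
              ≈⟨ sum-nested-cong {n} {d} (λ y a →
                   solve 3 (λ p w q → p :* (w :* q) := w :* (p :* q)) refl _ _ _) ⟩
            ∑[ y < n ] ∑[ a < d ] (w x y * (at f x a * (σ₀ x y · at f y) a))
              ≈⟨ sum-cong-≋ {n} (λ y → sym (*-distribˡ-sum {d} _ _)) ⟩
            ∑[ y < n ] (w x y * m x y) ∎

        square : ∀ x y → w x y * ⟨ difference f x y , difference f x y ⟩ ≈
                         w x y * u x - (w x y * m x y + w x y * m x y) + w x y * u y
        square x y = begin-equality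
          w x y * ⟨ difference f x y , difference f x y ⟩
            ≈⟨ *-congˡ (trans (sum-cong-≋ {d} (λ a →
                 solve 2 (λ p q → (p :- q) :* (p :- q) := p :* p :- (p :* q :+ p :* q) :+ q :* q) refl
                   (at f x a) (Tf a)))
                 (trans (∑-distrib-+ {d} _ _) (+-congʳ (trans (sum-distrib-sub {d} _ _)
                   (+-congˡ (-‿cong (∑-distrib-+ {d} _ _))))))) ⟩
          w x y * (u x - (m x y + m x y) + ⟨ Tf , Tf ⟩)
            ≈⟨ solve 4 (λ w u m t → w :* (u :- (m :+ m) :+ t) :=
                                    w :* u :- (w :* m :+ w :* m) :+ w :* t) refl _ _ _ _ ⟩
          w x y * u x - (w x y * m x y + w x y * m x y) + w x y * ⟨ Tf , Tf ⟩
            ≈⟨ +-congˡ (w-isometry x y (at f y)) ⟩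
          w x y * u x - (w x y * m x y + w x y * m x y) + w x y * u y ∎
          where
          Tf = σ₀ x y · at f y

        expand : ∑[ x < n ] ∑[ y < n ] (w x y * ⟨ difference f x y , difference f x y ⟩) ≈
                 D - (M + M) + D
        expand = begin-equality
          ∑[ x < n ] ∑[ y < n ] (w x y * ⟨ difference f x y , difference f x y ⟩)
            ≈⟨ sum-nested-cong square ⟩
          ∑[ x < n ] ∑[ y < n ] (w x y * u x - (w x y * m x y + w x y * m x y) + w x y * u y)
            ≈⟨ sum-cong-≋ {n} (λ x → trans (∑-distrib-+ {n} _ _) (+-congʳ (trans (sum-distrib-sub {n} _ _)
                 (+-cong (sym (*-distribʳ-sum {n} _ _)) (-‿cong (∑-distrib-+ {n} _ _)))))) ⟩
          ∑[ x < n ] (deg x * u x - (∑[ y < n ] (w x y * m x y) + ∑[ y < n ] (w x y * m x y)) +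
                      ∑[ y < n ] (w x y * u y))
            ≈⟨ trans (∑-distrib-+ {n} _ _) (+-cong (trans (sum-distrib-sub {n} _ _)
                 (+-congˡ (-‿cong (∑-distrib-+ {n} _ _)))) (∑-comm {n} {n} (λ x y → w x y * u y))) ⟩
          D - (M + M) + ∑[ y < n ] ∑[ x < n ] (w x y * u y)
            ≈⟨ +-congˡ (sum-cong-≋ {n} (λ y → trans (sum-cong-≋ {n} (λ x → *-congʳ (w-symm x y)))
                 (sym (*-distribʳ-sum {n} (u y) (w y))))) ⟩
          D - (M + M) + D ∎

      difference-energy-nonneg : ∀ f x y → 0# ≤ w x y * ⟨ difference f x y , difference f x y ⟩
      difference-energy-nonneg f x y = *-nonneg (w-nonneg x y) (⟨⟩-nonneg (difference f x y))

      difference-energy-≤ : ∀ f x y →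
        w x y * ⟨ difference f x y , difference f x y ⟩ ≤ 𝓔 f f + 𝓔 f f
      difference-energy-≤ f x y = ≤-trans
        (≤-trans (term≤sum (difference-energy-nonneg f x) y)
                 (term≤sum (λ x → sum-nonneg (difference-energy-nonneg f x)) x))
        (≈⇒≤ (𝓔-sum-of-squares f))

      𝓔-nonneg : ∀ f → 0# ≤ 𝓔 f f
      𝓔-nonneg f = *-cancelˡ-≤ 0<2 (begin
        (1# + 1#) * 0#
          ≈⟨ zeroʳ _ ⟩
        0#
          ≤⟨ sum-nonneg (λ x → sum-nonneg (difference-energy-nonneg f x)) ⟩
        ∑[ x < n ] ∑[ y < n ] (w x y * ⟨ difference f x y , difference f x y ⟩)
          ≈⟨ 𝓔-sum-of-squares f ⟩
        𝓔 f f + 𝓔 f f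
          ≈⟨ +-cong (*-identityˡ _) (*-identityˡ _) ⟨
        1# * 𝓔 f f + 1# * 𝓔 f f
          ≈⟨ distribʳ _ 1# 1# ⟨
        (1# + 1#) * 𝓔 f f ∎)

    VanishesAt : Fin n → (Fin (n ℕ.* d) → ℝ) → Set
    VanishesAt j f = ∀ a → at f j a ≈ 0#

    -- The constant does not depend on the signature: orthogonal transport
    -- preserves norms, so a field is estimated along a path leading to j.
    path-bound : ∀ {x j} → Star Edge x j → ∃[ C ] 0# ≤ C ×
      (∀ s f → VanishesAt j f → ⟨ at f x , at f x ⟩ ≤ C * 𝓔 s f f)
    path-bound Star.ε = 0# , ≈⇒≤ refl , λ s f f≈0 → ≈⇒≤ (trans
      (sum-zero {d} (λ a → trans (*-congʳ (f≈0 a)) (zeroˡ _))) (sym (zeroˡ _)))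
    path-bound {x} {j} (_◅_ {j = y} e path) with path-bound path
    ... | C , 0≤C , bound = C′ , 0≤C′ , λ s f f≈0 → begin
        ⟨ at f x , at f x ⟩
          ≤⟨ ⟨⟩-≤-double (at f x) (Signature.σ₀ s x y · at f y) ⟩
        (Q s f + Q s f) + (T s f + T s f)
          ≤⟨ +-mono-≤ (+-mono-≤ (Q-bound s f) (Q-bound s f))
               (+-mono-≤ (T-bound s f f≈0) (T-bound s f f≈0)) ⟩
        (i * (𝓔 s f f + 𝓔 s f f) + i * (𝓔 s f f + 𝓔 s f f)) + (C * 𝓔 s f f + C * 𝓔 s f f)
          ≈⟨ solve 3 (λ i E C → (i :* (E :+ E) :+ i :* (E :+ E)) :+ (C :* E :+ C :* E) :=
                               ((i :+ i) :+ (i :+ i) :+ (C :+ C)) :* E) refl _ _ _ ⟩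
        C′ * 𝓔 s f f ∎
      where
      i C′ : ℝ
      i = w x y ⁻¹
      -- The doubling inequality gives 2 `Q` + 2 `T`; the edge has `Q` at most twice the energy over
      -- `w x y`, and the remaining path has `T` at most `C` times the energy.
      C′ = (i + i) + (i + i) + (C + C)
      0≤i = ⁻¹-nonneg (inj₁ e)
      0≤C′ = 0≤+ (0≤+ (0≤+ 0≤i 0≤i) (0≤+ 0≤i 0≤i)) (0≤+ 0≤C 0≤C)

      Q T : Signature G d → (Fin (n ℕ.* d) → ℝ) → ℝ
      Q s f = ⟨ difference s f x y , difference s f x y ⟩
      T s f = ⟨ Signature.σ₀ s x y · at f y , Signature.σ₀ s x y · at f y ⟩

      Q-bound : ∀ s f → Q s f ≤ i * (𝓔 s f f + 𝓔 s f f)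
      Q-bound s f = *-cancelˡ-≤ e (≤-trans (difference-energy-≤ s f x y) (≈⇒≤ (sym (begin-equality
        w x y * (i * _)   ≈⟨ *-assoc _ _ _ ⟨
        w x y * i * _     ≈⟨ *-congʳ (*-⁻¹ (pos⇒≉0 e)) ⟩
        1# * _            ≈⟨ *-identityˡ _ ⟩
        _                 ∎))))

      T-bound : ∀ s f → VanishesAt j f → T s f ≤ C * 𝓔 s f f
      T-bound s f f≈0 = *-cancelˡ-≤ e (≤-trans (≈⇒≤ (w-isometry s x y (at f y)))
        (*-monoʳ-≤ (inj₁ e) (bound s f f≈0)))

    -- Summing the path constants over all nodes gives a single constant, chosen before the
    -- signature; this is what makes the later estimates uniform.
    coercive : Connected → ∀ j → ∃[ C ] 0# ≤ C ×
      (∀ s f → VanishesAt j f → ∀ x a → at f x a * at f x a ≤ C * 𝓔 s f f)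
    coercive connected j = sum C , sum-nonneg C-nonneg , λ s f f≈0 x a → begin
      at f x a * at f x a   ≤⟨ term≤sum (λ b → sq-nonneg (at f x b)) a ⟩
      ⟨ at f x , at f x ⟩   ≤⟨ proj₂ (proj₂ (path-bound (connected x j))) s f f≈0 ⟩
      C x * 𝓔 s f f         ≤⟨ *-monoˡ-≤ (𝓔-nonneg s f) (term≤sum C-nonneg x) ⟩
      sum C * 𝓔 s f f       ∎
      where
      C : Fin n → ℝ
      C x = proj₁ (path-bound (connected x j))
      C-nonneg : ∀ x → 0# ≤ C x
      C-nonneg x = proj₁ (proj₂ (path-bound (connected x j)))

-- First-step analysis of the expected transport.

module Hitting (𝓡 : CompleteOrderedField) where

  open Real 𝓡
  open RingSolving 𝓡
  open Analysis 𝓡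
  open Energy 𝓡

  sumWords-∑ : ∀ {n m} t (f : Fin m → Vec (Fin n) t → ℝ) →
               sumWords t (λ xs → ∑[ c < m ] f c xs) ≈ ∑[ c < m ] sumWords t (f c)
  sumWords-∑         zero    f = refl
  sumWords-∑ {n} {m} (suc t) f = trans
    (sum-cong-≋ (λ y → sumWords-∑ t (λ c ys → f c (y ∷ ys))))
    (∑-comm {n} {m} (λ y c → sumWords t (λ ys → f c (y ∷ ys))))

  module OnSignature {n d : ℕ} {G : WeightedGraph n} (s : Signature G d) where

    open WeightedGraph G
    open Signature s
    open Walk G
    open OnGraph G d using (at; 𝓛-·)

    transportAt : Fin n → Fin n → Fin d → Fin d → ℕ → ℝ
    transportAt x j a b = expectationAt (transport-entry a b) j x

    -- The first letter of each word is split off: it contributes the transition probability, and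
    -- the matrix product contributes the sum over the inner index `c`.
    transportAt-suc : ∀ {x j} a b t → x ≢ j → transportAt x j a b (suc t) ≈
      ∑[ y < n ] ∑[ c < d ] (p x y * σ₀ x y a c * transportAt y j c b t)
    transportAt-suc {x} {j} a b t x≢j with x Fin.≟ j
    ... | yes x≡j = ⊥-elim (x≢j x≡j)
    ... | no _    = sum-cong-≋ {n} λ y → trans (sumWords-cong t (pull y))
      (trans (sumWords-∑ t (λ c ys → p x y * σ₀ x y a c * term y c ys))
        (sum-cong-≋ {d} (λ c → *-distribˡ-sumWords t (p x y * σ₀ x y a c) (term y c))))
      where
      term : ∀ y c → Vec (Fin n) t → ℝ
      term y c ys = if does (firstHits? j y ys) then probability y ys * transport y ys c b else 0#

      pull : ∀ y ys →
        (if does (firstHits? j y ys) then p x y * probability y ys * transport x (y ∷ ys) a b else 0#) ≈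
        ∑[ c < d ] (p x y * σ₀ x y a c * term y c ys)
      pull y ys with does (firstHits? j y ys)
      ... | true  = trans (*-distribˡ-sum {d} _ _) (sum-cong-≋ {d} (λ c → solve 4
        (λ p q σ t → p :* q :* (σ :* t) := p :* σ :* (q :* t)) refl
        (p x y) (probability y ys) (σ₀ x y a c) (transport y ys c b)))
      ... | false = sym (sum-zero {d} (λ c → zeroʳ _))

    transportAt-zero : ∀ {x j} a b → x ≢ j → transportAt x j a b 0 ≈ 0#
    transportAt-zero {x} {j} a b x≢j with x Fin.≟ j
    ... | yes x≡j = ⊥-elim (x≢j x≡j)
    ... | no _    = refl

    transportAt-zero-≡ : ∀ j a b → transportAt j j a b 0 ≈ 1ᴹ a b
    transportAt-zero-≡ j a b with j Fin.≟ j
    ... | yes _  = *-identityˡ _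
    ... | no j≢j = ⊥-elim (j≢j ≡.refl)

    transportAt-suc-≡ : ∀ j a b t → transportAt j j a b (suc t) ≈ 0#
    transportAt-suc-≡ j a b t with j Fin.≟ j
    ... | yes _  = sum-zero {n} (λ y → sumWords-zero t (λ _ → refl))
    ... | no j≢j = ⊥-elim (j≢j ≡.refl)

    remainder-null : ∀ x j a b → Null (λ N → partialSum (transportAt x j a b) N - Ω⁰ x j a b)
    remainder-null x j a b = ⟶⇒null {s = partialSum (transportAt x j a b)} (Ω⁰-isExpectation x j a b)

    -- From `j` the walk stops at time 0 with the empty product, so every partial sum with at least
    -- one term already equals the identity; `null-tail` drops the empty sum.
    Ω⁰-diagonal : ∀ j a b → Ω⁰ j j a b ≈ 1ᴹ a b
    Ω⁰-diagonal j a b = sym (x-y≈0⇒x≈y (null-constant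
      (null-resp-≈ (λ N → +-congʳ (total N)) (null-tail (remainder-null j j a b)))))
      where
      total : ∀ N → partialSum (transportAt j j a b) (suc N) ≈ 1ᴹ a b
      total N = trans (+-cong (transportAt-zero-≡ j a b)
        (sum-zero {N} (λ t → transportAt-suc-≡ j a b (toℕ t)))) (+-identityʳ _)

    -- Conditioning on the first step of the walk.
    Ω⁰-harmonic : ∀ {x j} → x ≢ j → ∀ a b →
      Ω⁰ x j a b ≈ ∑[ y < n ] ∑[ c < d ] (p x y * σ₀ x y a c * Ω⁰ y j c b)
    Ω⁰-harmonic {x} {j} x≢j a b = sym (x-y≈0⇒x≈y (null-constant (null-resp-≈ combine-limits
      (null-+ (null-tail (remainder-null x j a b))
        (null-neg (null-sum {n} λ y → null-sum {d} λ c → null-* (k y c) (remainder-null y j c b)))))))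
      where
      k : Fin n → Fin d → ℝ
      k y c = p x y * σ₀ x y a c

      S : ℕ → Fin n → Fin d → ℝ
      S N y c = partialSum (transportAt y j c b) N

      -- The term at time 0 vanishes and one step is consumed, so N + 1 terms at `x` correspond to N
      -- terms at the next node.
      step : ∀ N → partialSum (transportAt x j a b) (suc N) ≈ ∑[ y < n ] ∑[ c < d ] (k y c * S N y c)
      step N = begin-equality
        transportAt x j a b 0 + ∑[ t < N ] transportAt x j a b (suc (toℕ t))
          ≈⟨ +-cong (transportAt-zero a b x≢j)
               (sum-cong-≋ {N} (λ t → transportAt-suc a b (toℕ t) x≢j)) ⟩
        0# + ∑[ t < N ] ∑[ y < n ] ∑[ c < d ] (k y c * transportAt y j c b (toℕ t))
          ≈⟨ +-identityˡ _ ⟩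
        ∑[ t < N ] ∑[ y < n ] ∑[ c < d ] (k y c * transportAt y j c b (toℕ t))
          ≈⟨ ∑-comm {N} {n} _ ⟩
        ∑[ y < n ] ∑[ t < N ] ∑[ c < d ] (k y c * transportAt y j c b (toℕ t))
          ≈⟨ sum-cong-≋ {n} (λ y → ∑-comm {N} {d} _) ⟩
        ∑[ y < n ] ∑[ c < d ] ∑[ t < N ] (k y c * transportAt y j c b (toℕ t))
          ≈⟨ sum-nested-cong {n} {d} (λ y c → sym (*-distribˡ-sum {N} _ _)) ⟩
        ∑[ y < n ] ∑[ c < d ] (k y c * S N y c) ∎

      remainders : ∀ N →
        ∑[ y < n ] ∑[ c < d ] (k y c * (S N y c - Ω⁰ y j c b)) ≈
        ∑[ y < n ] ∑[ c < d ] (k y c * S N y c) - ∑[ y < n ] ∑[ c < d ] (k y c * Ω⁰ y j c b)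
      remainders N = trans (sum-cong-≋ {n} (λ y → trans
        (sum-cong-≋ {d} (λ c → solve 3 (λ k s o → k :* (s :- o) := k :* s :- k :* o) refl
          (k y c) (S N y c) (Ω⁰ y j c b)))
        (sum-distrib-sub {d} _ _))) (sum-distrib-sub {n} _ _)

      -- The partial sums cancel, which leaves a constant null sequence.
      combine-limits : ∀ N →
        (partialSum (transportAt x j a b) (suc N) - Ω⁰ x j a b) -
        ∑[ y < n ] ∑[ c < d ] (k y c * (S N y c - Ω⁰ y j c b)) ≈
        ∑[ y < n ] ∑[ c < d ] (k y c * Ω⁰ y j c b) - Ω⁰ x j a b
      combine-limits N = trans (+-cong (+-congʳ (step N)) (-‿cong (remainders N)))
        (solve 3 (λ s o t → (s :- o) :- (s :- t) := t :- o) refl _ _ _)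

    -- The operator extending a vector at `j` harmonically to all nodes; column `b` extends the
    -- basis vector with index `b`.
    𝓗 : Fin n → Matrix (n ℕ.* d) d
    𝓗 j = fromBlockColumn (λ x → Ω⁰ x j)

    𝓗-block : ∀ j x a b → 𝓗 j (combine x a) b ≈ Ω⁰ x j a b
    𝓗-block j x a b = reflexive (fromBlockColumn-combine (λ x → Ω⁰ x j) x a b)

    -- This is `Ω⁰-harmonic` multiplied by the degree, which turns transition probabilities back
    -- into weights.
    𝓛𝓗≈0 : ∀ {x j} → x ≢ j → 0# < deg x → ∀ a b → (𝓛 ⊗ 𝓗 j) (combine x a) b ≈ 0#
    𝓛𝓗≈0 {x} {j} x≢j 0<deg a b = begin-equality
      (𝓛 ⊗ 𝓗 j) (combine x a) b
        ≈⟨ 𝓛-· s (λ r → 𝓗 j r b) x a ⟩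
      deg x * 𝓗 j (combine x a) b - ∑[ y < n ] (w x y * ∑[ c < d ] (σ₀ x y a c * 𝓗 j (combine y c) b))
        ≈⟨ +-cong (*-congˡ (𝓗-block j x a b)) (-‿cong (sum-cong-≋ {n} (λ y →
             *-congˡ (sum-cong-≋ {d} (λ c → *-congˡ (𝓗-block j y c b)))))) ⟩
      deg x * Ω⁰ x j a b - ∑[ y < n ] (w x y * ∑[ c < d ] (σ₀ x y a c * Ω⁰ y j c b))
        ≈⟨ +-congʳ (*-congˡ (Ω⁰-harmonic x≢j a b)) ⟩
      deg x * ∑[ y < n ] ∑[ c < d ] (p x y * σ₀ x y a c * Ω⁰ y j c b) -
      ∑[ y < n ] (w x y * ∑[ c < d ] (σ₀ x y a c * Ω⁰ y j c b))
        ≈⟨ +-congʳ (trans (*-distribˡ-sum {n} _ _) (sum-cong-≋ {n} step)) ⟩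
      ∑[ y < n ] (w x y * ∑[ c < d ] (σ₀ x y a c * Ω⁰ y j c b)) -
      ∑[ y < n ] (w x y * ∑[ c < d ] (σ₀ x y a c * Ω⁰ y j c b))
        ≈⟨ -‿inverseʳ _ ⟩
      0# ∎
      where
      step : ∀ y → deg x * ∑[ c < d ] (p x y * σ₀ x y a c * Ω⁰ y j c b) ≈
                   w x y * ∑[ c < d ] (σ₀ x y a c * Ω⁰ y j c b)
      step y = begin-equality
        deg x * ∑[ c < d ] (p x y * σ₀ x y a c * Ω⁰ y j c b)
          ≈⟨ *-congˡ (trans (sum-cong-≋ {d} (λ c → *-assoc _ _ _)) (sym (*-distribˡ-sum {d} _ _))) ⟩
        deg x * (p x y * ∑[ c < d ] (σ₀ x y a c * Ω⁰ y j c b))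
          ≈⟨ *-assoc _ _ _ ⟨
        deg x * (w x y / deg x) * ∑[ c < d ] (σ₀ x y a c * Ω⁰ y j c b)
          ≈⟨ *-congʳ (*-/-cancel (w x y) 0<deg) ⟩
        w x y * ∑[ c < d ] (σ₀ x y a c * Ω⁰ y j c b) ∎

-- Grounding, solvability and Green's functions.

module Green (𝓡 : CompleteOrderedField) where

  open Real 𝓡
  open RingSolving 𝓡
  open Analysis 𝓡
  open Energy 𝓡
  open Hitting 𝓡

  ⟨⟩-comm : ∀ {n} (x y : Fin n → ℝ) → ⟨ x , y ⟩ ≈ ⟨ y , x ⟩
  ⟨⟩-comm x y = sum-cong-≋ (λ k → *-comm (x k) (y k))

  ⟨⟩-distrib-sub : ∀ {n} (x y z : Fin n → ℝ) →
                   ⟨ x , (λ k → y k - z k) ⟩ ≈ ⟨ x , y ⟩ - ⟨ x , z ⟩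
  ⟨⟩-distrib-sub {n} x y z = trans
    (sum-cong-≋ {n} (λ k → solve 3 (λ x y z → x :* (y :- z) := x :* y :- x :* z) refl (x k) (y k) (z k)))
    (sum-distrib-sub {n} _ _)

  ⊗-· : ∀ {l m n} (A : Matrix l m) (B : Matrix m n) v → ∀ r → ((A ⊗ B) · v) r ≈ (A · (B · v)) r
  ⊗-· {n = n} A B v r = ⊗-assoc A B V r zero
    where
    V : Matrix n 1
    V k _ = v k

  ⟨⟩-·-symm : ∀ {n} {A : Matrix n n} → A ᵀ ≋ A → ∀ x y → ⟨ x , A · y ⟩ ≈ ⟨ y , A · x ⟩
  ⟨⟩-·-symm {n} {A} Aᵀ≋A x y = begin-equality
    ∑[ k < n ] (x k * ∑[ l < n ] (A k l * y l))
      ≈⟨ sum-cong-≋ {n} (λ k → *-distribˡ-sum {n} _ _) ⟩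
    ∑[ k < n ] ∑[ l < n ] (x k * (A k l * y l))
      ≈⟨ ∑-comm {n} {n} _ ⟩
    ∑[ l < n ] ∑[ k < n ] (x k * (A k l * y l))
      ≈⟨ sum-nested-cong {n} {n} (λ l k → trans
           (solve 3 (λ x A y → x :* (A :* y) := y :* (A :* x)) refl _ _ _)
           (*-congˡ (*-congʳ (Aᵀ≋A l k)))) ⟩
    ∑[ l < n ] ∑[ k < n ] (y l * (A l k * x k))
      ≈⟨ sum-cong-≋ {n} (λ l → *-distribˡ-sum {n} _ _) ⟨
    ∑[ l < n ] (y l * ∑[ k < n ] (A l k * x k)) ∎

  sq≤0⇒≈0 : ∀ {x} → x * x ≤ 0# → x ≈ 0#
  sq≤0⇒≈0 {x} x²≤0 with x ≟ 0#
  ... | yes x≈0 = x≈0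
  ... | no x≉0  = ⊥-elim (<-irrefl refl (<-≤-trans (sq-pos x≉0) x²≤0))

  -- The range of A is the orthogonal complement of the kernel of Aᵀ.
  †-solves : ∀ {m n} (A : Matrix m n) (v : Fin m → ℝ) →
    (∀ u → (∀ k → ⟨ (λ r → A r k) , u ⟩ ≈ 0#) → ⟨ u , v ⟩ ≈ 0#) →
    ∀ r → (A · (A † · v)) r ≈ v r
  †-solves {m} A v kernel⊥v r = sym (x-y≈0⇒x≈y (sum-sq-zero u ⟨u,u⟩≈0 r))
    where
    open IsMoorePenroseInverse (†-isMoorePenroseInverse A)

    z : Fin _ → ℝ
    z = A † · v

    u : Fin m → ℝ
    u r = v r - (A · z) r

    -- Transposing `A ⊗ A † ⊗ A ≋ A` and using the symmetry of `A ⊗ A †`; it makes the residual `u`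
    -- orthogonal to every column of `A`.
    AᵀAA†≋Aᵀ : A ᵀ ⊗ (A ⊗ A †) ≋ A ᵀ
    AᵀAA†≋Aᵀ = ≋-trans (⊗-congˡ (A ᵀ) (≋-sym AX-symm))
      (≋-trans (≋-sym (⊗-ᵀ (A ⊗ A †) A)) (ᵀ-cong AXA≋A))

    kernel : ∀ k → ⟨ (λ r → A r k) , u ⟩ ≈ 0#
    kernel k = begin-equality
      ⟨ (A ᵀ) k , u ⟩
        ≈⟨ ⟨⟩-distrib-sub ((A ᵀ) k) v (A · z) ⟩
      ⟨ (A ᵀ) k , v ⟩ - ⟨ (A ᵀ) k , A · z ⟩
        ≈⟨ +-congˡ (-‿cong (⟨⟩-congˡ ((A ᵀ) k) (⊗-· A (A †) v))) ⟨
      ⟨ (A ᵀ) k , v ⟩ - ⟨ (A ᵀ) k , (A ⊗ A †) · v ⟩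
        ≈⟨ +-congˡ (-‿cong (⊗-· (A ᵀ) (A ⊗ A †) v k)) ⟨
      ⟨ (A ᵀ) k , v ⟩ - ⟨ (A ᵀ ⊗ (A ⊗ A †)) k , v ⟩
        ≈⟨ +-congˡ (-‿cong (⟨⟩-congʳ v (AᵀAA†≋Aᵀ k))) ⟩
      ⟨ (A ᵀ) k , v ⟩ - ⟨ (A ᵀ) k , v ⟩
        ≈⟨ -‿inverseʳ _ ⟩
      0# ∎

    -- The residual is orthogonal to `v` by hypothesis and to `A · z` as a combination of columns,
    -- hence to itself.
    ⟨u,u⟩≈0 : ⟨ u , u ⟩ ≈ 0#
    ⟨u,u⟩≈0 = begin-equality
      ⟨ u , u ⟩                   ≈⟨ ⟨⟩-distrib-sub u v (A · z) ⟩
      ⟨ u , v ⟩ - ⟨ u , A · z ⟩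
        ≈⟨ +-cong (kernel⊥v u kernel) (-‿cong (trans (⟨⟩-comm u (A · z)) (⟨⟩-orth A z u kernel))) ⟩
      0# - 0#                     ≈⟨ -‿inverseʳ 0# ⟩
      0#                          ∎

  module OnConnected {n : ℕ} (G : WeightedGraph n) (d : ℕ) (connected : WeightedGraph.Connected G) where

    open WeightedGraph G
    open OnGraph G d

    -- A path from `x` to a different node begins with an edge, whose weight is a summand of the
    -- degree.
    deg-pos : ∀ {x y} → x ≢ y → 0# < deg x
    deg-pos {x} {y} x≢y with connected x y
    ... | Star.ε = ⊥-elim (x≢y ≡.refl)
    ... | e ◅ _  = <-≤-trans e (term≤sum (w-nonneg x) _)

    -- X solves the Dirichlet problem grounded at j with source e_c at i.
    IsGreen : Signature G d → Fin n → Fin n → Fin d → (Fin (n ℕ.* d) → ℝ) → Set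
    IsGreen s i j c X = VanishesAt j X × (∀ g → VanishesAt j g → 𝓔 s g X ≈ at g i c)

    module _ (s : Signature G d) where

      open Signature s
      open OnSignature s

      𝓛-symm : 𝓛 ᵀ ≋ 𝓛
      𝓛-symm r q = block-symm (quotient d r) (quotient d q) (remainder {n} d r) (remainder {n} d q)
        where
        block : Fin n → Fin n → Matrix d d
        block x y = if does (x Fin.≟ y) then deg x ·ᴹ 1ᴹ else (- w x y) ·ᴹ σ₀ x y

        block-symm : ∀ y x b a → block x y a b ≈ block y x b a
        block-symm y x b a with x Fin.≟ y | y Fin.≟ x
        ... | yes ≡.refl | yes _ = *-congˡ (1ᴹ-symm a b)
        ... | no _  | no _       = *-cong (-‿cong (w-symm x y)) (sym (σ₀-ᵀ s x y b a))
        ... | yes p | no q       = ⊥-elim (q (≡.sym p))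
        ... | no q  | yes p      = ⊥-elim (q (≡.sym p))

      ground : Fin n → (Fin (n ℕ.* d) → ℝ) → Fin (n ℕ.* d) → ℝ
      ground j f r = f r - (𝓗 j · at f j) r

      ground-vanishes : ∀ j f → VanishesAt j (ground j f)
      ground-vanishes j f a = begin-equality
        at f j a - ⟨ 𝓗 j (combine j a) , at f j ⟩
          ≈⟨ +-congˡ (-‿cong (⟨⟩-congʳ (at f j) (λ b → trans (𝓗-block j j a b) (Ω⁰-diagonal j a b)))) ⟩
        at f j a - ⟨ 1ᴹ a , at f j ⟩
          ≈⟨ +-congˡ (-‿cong (trans (sum-cong-≋ {d} (λ b → trans (*-comm _ _) (*-congˡ (1ᴹ-symm a b))))
               (sum-1ᴹ (at f j) a))) ⟩
        at f j a - at f j a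
          ≈⟨ -‿inverseʳ _ ⟩
        0# ∎

      ground-vanishing : ∀ {j f} → VanishesAt j f → ∀ r → ground j f r ≈ f r
      ground-vanishing {j} {f} f≈0 r = begin-equality
        f r - ⟨ 𝓗 j r , at f j ⟩
          ≈⟨ +-congˡ (-‿cong (sum-zero {d} (λ b → trans (*-congˡ (f≈0 b)) (zeroʳ _)))) ⟩
        f r - 0#
          ≈⟨ solve 2 (λ x z → x :- z := x :+ (z :- (z :+ z))) refl _ _ ⟩
        f r + (0# - (0# + 0#))
          ≈⟨ +-congˡ (trans (+-congˡ (-‿cong (+-identityʳ 0#))) (-‿inverseʳ 0#)) ⟩
        f r + 0#
          ≈⟨ +-identityʳ _ ⟩
        f r ∎

      𝓛-ground : ∀ {x j} f → x ≢ j → ∀ a → (𝓛 · ground j f) (combine x a) ≈ (𝓛 · f) (combine x a)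
      𝓛-ground {x} {j} f x≢j a = begin-equality
        (𝓛 · ground j f) r
          ≈⟨ ⟨⟩-distrib-sub (𝓛 r) f (𝓗 j · at f j) ⟩
        (𝓛 · f) r - (𝓛 · (𝓗 j · at f j)) r
          ≈⟨ +-congˡ (-‿cong (⊗-· 𝓛 (𝓗 j) (at f j) r)) ⟨
        (𝓛 · f) r - ((𝓛 ⊗ 𝓗 j) · at f j) r
          ≈⟨ +-congˡ (-‿cong (sum-zero {d} (λ b → trans (*-congʳ (𝓛𝓗≈0 x≢j (deg-pos x≢j) a b)) (zeroˡ _)))) ⟩
        (𝓛 · f) r - 0#
          ≈⟨ trans (+-congˡ -0#≈0#) (+-identityʳ _) ⟩
        (𝓛 · f) r ∎
        where
        r = combine x a

      -- Grounding changes `𝓛 · f` only at `j`, where the test field `g` vanishes.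
      𝓔-ground : ∀ {j g} f → VanishesAt j g → 𝓔 s g (ground j f) ≈ 𝓔 s g f
      𝓔-ground {j} {g} f g≈0 = trans (sum-combine n _)
        (trans (sum-nested-cong {n} {d} term) (sym (sum-combine n _)))
        where
        term : ∀ x a → at g x a * (𝓛 · ground j f) (combine x a) ≈ at g x a * (𝓛 · f) (combine x a)
        term x a with x Fin.≟ j
        ... | yes ≡.refl = trans (trans (*-congʳ (g≈0 a)) (zeroˡ _))
                                 (sym (trans (*-congʳ (g≈0 a)) (zeroˡ _)))
        ... | no x≢j     = *-congˡ (𝓛-ground f x≢j a)

      -- By `𝓔-ground` the second argument of the energy of `ground j f` may be replaced by `f`,
      -- which `𝓛` annihilates; the energy is then 0 and coercivity applies.
      kernel⇒ground≈0 : ∀ j f → (∀ r → (𝓛 · f) r ≈ 0#) → ∀ x a → at (ground j f) x a ≈ 0#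
      kernel⇒ground≈0 j f 𝓛f≈0 x a = sq≤0⇒≈0 (begin
        at (ground j f) x a * at (ground j f) x a
          ≤⟨ proj₂ (proj₂ (coercive connected j)) s (ground j f) (ground-vanishes j f) x a ⟩
        C * 𝓔 s (ground j f) (ground j f)
          ≈⟨ *-congˡ (𝓔-ground {j} f (ground-vanishes j f)) ⟩
        C * 𝓔 s (ground j f) f
          ≈⟨ *-congˡ (sum-zero {n ℕ.* d} (λ r → trans (*-congˡ (𝓛f≈0 r)) (zeroʳ _))) ⟩
        C * 0#
          ≈⟨ zeroʳ C ⟩
        0# ∎)
        where
        C = proj₁ (coercive connected j)

      module _ {i j : Fin n} (i≢j : i ≢ j) where

        N-column : Fin d → Fin (n ℕ.* d) → ℝ
        N-column c r = N i j r c

        -- Since `i` and `j` differ, the nested cases are disjoint and merge into one formula that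
        -- `sum-1ᴹ` can sum.
        N-block : ∀ x a c → N i j (combine x a) c ≈ 1ᴹ a c * 1ᴹ x i - Ω⁰ i j c a * 1ᴹ x j
        N-block x a c = trans (reflexive (fromBlockColumn-combine (λ x →
          if does (x Fin.≟ i) then 1ᴹ
          else if does (x Fin.≟ j) then -ᴹ (Ω⁰ i j ᵀ)
          else 0ᴹ) x a c)) block
          where
          block : (if does (x Fin.≟ i) then 1ᴹ
                   else if does (x Fin.≟ j) then -ᴹ (Ω⁰ i j ᵀ)
                   else 0ᴹ) a c ≈ 1ᴹ a c * 1ᴹ x i - Ω⁰ i j c a * 1ᴹ x j
          block with x Fin.≟ i | x Fin.≟ j
          ... | yes ≡.refl | yes p = ⊥-elim (i≢j p)
          ... | yes _ | no _  = begin-equality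
            1ᴹ a c                             ≈⟨ +-identityʳ _ ⟨
            1ᴹ a c + 0#                        ≈⟨ +-cong (sym (*-identityʳ _)) (trans (sym -0#≈0#) (-‿cong (sym (zeroʳ _)))) ⟩
            1ᴹ a c * 1# - Ω⁰ i j c a * 0#      ∎
          ... | no _  | yes _ = begin-equality
            - Ω⁰ i j c a                       ≈⟨ +-identityˡ _ ⟨
            0# - Ω⁰ i j c a                    ≈⟨ +-cong (sym (zeroʳ _)) (-‿cong (sym (*-identityʳ _))) ⟩
            1ᴹ a c * 0# - Ω⁰ i j c a * 1#      ∎
          ... | no _  | no _  = begin-equality
            0#                                 ≈⟨ -‿inverseʳ 0# ⟨
            0# - 0#                            ≈⟨ +-cong (sym (zeroʳ _)) (-‿cong (sym (zeroʳ _))) ⟩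
            1ᴹ a c * 0# - Ω⁰ i j c a * 0#      ∎

        -- The block at `i` evaluates `f` there and the block at `j` subtracts the harmonic
        -- extension of its value at `j`, so the column of `N` represents evaluation at `i` after
        -- grounding.
        ⟨⟩-N : ∀ f c → ⟨ f , N-column c ⟩ ≈ at (ground j f) i c
        ⟨⟩-N f c = begin-equality
          ⟨ f , N-column c ⟩
            ≈⟨ sum-combine n _ ⟩
          ∑[ x < n ] ∑[ a < d ] (at f x a * N i j (combine x a) c)
            ≈⟨ sum-nested-cong {n} {d} (λ x a → trans (*-congˡ (N-block x a c))
                 (solve 5 (λ f o I ω J → f :* (o :* I :- ω :* J) := f :* o :* I :- ω :* f :* J) refl
                   (at f x a) (1ᴹ a c) (1ᴹ x i) (Ω⁰ i j c a) (1ᴹ x j))) ⟩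
          ∑[ x < n ] ∑[ a < d ] (at f x a * 1ᴹ a c * 1ᴹ x i - Ω⁰ i j c a * at f x a * 1ᴹ x j)
            ≈⟨ sum-cong-≋ {n} (λ x → trans (sum-distrib-sub {d} _ _)
                 (+-cong (trans (sym (*-distribʳ-sum {d} _ _)) (*-congʳ (sum-1ᴹ (at f x) c)))
                         (-‿cong (sym (*-distribʳ-sum {d} _ _))))) ⟩
          ∑[ x < n ] (at f x c * 1ᴹ x i - ⟨ Ω⁰ i j c , at f x ⟩ * 1ᴹ x j)
            ≈⟨ sum-distrib-sub {n} _ _ ⟩
          ∑[ x < n ] (at f x c * 1ᴹ x i) - ∑[ x < n ] (⟨ Ω⁰ i j c , at f x ⟩ * 1ᴹ x j)
            ≈⟨ +-cong (sum-1ᴹ (λ x → at f x c) i) (-‿cong (sum-1ᴹ (λ x → ⟨ Ω⁰ i j c , at f x ⟩) j)) ⟩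
          at f i c - ⟨ Ω⁰ i j c , at f j ⟩
            ≈⟨ +-congˡ (-‿cong (⟨⟩-congʳ (at f j) (λ b → 𝓗-block j i c b))) ⟨
          at (ground j f) i c ∎

        potential : Fin d → Fin (n ℕ.* d) → ℝ
        potential c r = 𝓦 i j r c

        -- A kernel field grounds to zero, so by `⟨⟩-N` it is orthogonal to the source. Symmetry of
        -- `𝓛` identifies its kernel with that of the transpose, as `†-solves` requires.
        𝓛-potential : ∀ c r → (𝓛 · potential c) r ≈ N i j r c
        𝓛-potential c = †-solves 𝓛 (N-column c) λ u u⊥ → trans (⟨⟩-N u c)
          (kernel⇒ground≈0 j u (λ r → trans (⟨⟩-congʳ u (λ q → sym (𝓛-symm r q))) (u⊥ r)) i c)

        green : Fin d → Fin (n ℕ.* d) → ℝ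
        green c = ground j (potential c)

        -- Against test fields vanishing at `j`, grounding the potential does not change the energy
        -- pairing, and the source acts as plain evaluation at `i`.
        green-isGreen : ∀ c → IsGreen s i j c (green c)
        green-isGreen c = ground-vanishes j (potential c) , λ g g≈0 → begin-equality
          𝓔 s g (green c)          ≈⟨ 𝓔-ground {j} (potential c) g≈0 ⟩
          𝓔 s g (potential c)      ≈⟨ ⟨⟩-congˡ g (𝓛-potential c) ⟩
          ⟨ g , N-column c ⟩       ≈⟨ ⟨⟩-N g c ⟩
          at (ground j g) i c      ≈⟨ ground-vanishing {j} {g} g≈0 (combine i c) ⟩
          at g i c                 ∎

        -- Here the pseudoinverse leaves the problem: the ambiguity of the potential modulo the
        -- kernel is removed by grounding.
        𝓦𝓛𝓦-diagonal : ∀ c → (𝓦 i j ᵀ ⊗ 𝓛 ⊗ 𝓦 i j) c c ≈ at (green c) i c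
        𝓦𝓛𝓦-diagonal c = begin-equality
          (𝓦 i j ᵀ ⊗ 𝓛 ⊗ 𝓦 i j) c c           ≈⟨ ⊗-assoc (𝓦 i j ᵀ) 𝓛 (𝓦 i j) c c ⟩
          ⟨ potential c , 𝓛 · potential c ⟩   ≈⟨ ⟨⟩-congˡ (potential c) (𝓛-potential c) ⟩
          ⟨ potential c , N-column c ⟩        ≈⟨ ⟨⟩-N (potential c) c ⟩
          at (green c) i c                    ∎

-- Lipschitz dependence on the signature.

module Continuity (𝓡 : CompleteOrderedField) where

  open Real 𝓡
  open RingSolving 𝓡
  open Analysis 𝓡
  open Energy 𝓡
  open Green 𝓡

  module _ {n d : ℕ} {G : WeightedGraph n} where

    -- Refers to the largest entrywise distance over the edges, expressed through its upper bounds δ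
    -- so that no maximum has to be formed.
    Lipschitz : (Signature G d → ℝ) → Set
    Lipschitz F = ∃[ K ] 0# ≤ K ×
      (∀ {δ} → 0# ≤ δ → ∀ s τ → Close δ s τ → Bounded (K * δ) (F τ - F s))

    lipschitz-resp-≈ : ∀ {F F′} → (∀ s → F s ≈ F′ s) → Lipschitz F → Lipschitz F′
    lipschitz-resp-≈ F≈F′ (K , 0≤K , bound) = K , 0≤K , λ 0≤δ s τ close →
      bounded-resp-≈ (+-cong (F≈F′ τ) (-‿cong (F≈F′ s))) (bound 0≤δ s τ close)

    lipschitz-+ : ∀ {F F′} → Lipschitz F → Lipschitz F′ → Lipschitz (λ s → F s + F′ s)
    lipschitz-+ {F} {F′} (K , 0≤K , bound) (K′ , 0≤K′ , bound′) =
      K + K′ , 0≤+ 0≤K 0≤K′ , λ {δ} 0≤δ s τ close →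
        bounded-weaken (≈⇒≤ (sym (distribʳ δ K K′))) (bounded-resp-≈
          (solve 4 (λ a b c d → (a :- b) :+ (c :- d) := (a :+ c) :- (b :+ d)) refl
            (F τ) (F s) (F′ τ) (F′ s))
          (bounded-+ (bound 0≤δ s τ close) (bound′ 0≤δ s τ close)))

    lipschitz-sum : ∀ {m} {F : Fin m → Signature G d → ℝ} →
                    (∀ k → Lipschitz (F k)) → Lipschitz (λ s → ∑[ k < m ] F k s)
    lipschitz-sum {zero}  _ = 0# , ≈⇒≤ refl , λ _ _ _ _ →
      bounded-zero (≈⇒≤ (sym (zeroˡ _))) (-‿inverseʳ 0#)
    lipschitz-sum {suc m} p = lipschitz-+ (p zero) (lipschitz-sum (p ∘ suc))

    lipschitz-* : ∀ {F} c → Lipschitz F → Lipschitz (λ s → c * F s)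
    lipschitz-* {F} c (K , 0≤K , bound) = B * K , *-nonneg 0≤B 0≤K , λ {δ} 0≤δ s τ close →
      bounded-weaken (≈⇒≤ (sym (*-assoc B K δ))) (bounded-resp-≈
        (solve 3 (λ c x y → c :* (x :- y) := c :* x :- c :* y) refl c (F τ) (F s))
        (bounded-* 0≤B (bounded-by-sq c) (bound 0≤δ s τ close)))
      where
      B = 1# + c * c
      0≤B : 0# ≤ B
      0≤B = inj₁ (0<1+sq c)

    lipschitz⇒continuous : ∀ {F} → Lipschitz F → Continuous F
    lipschitz⇒continuous {F} (K , 0≤K , bound) s ε 0<ε = δ , 0<δ , λ τ close →
      let p , q = bound (inj₁ 0<δ) s τ close
      in ∣∣<-intro (≤-<-trans p Kδ<ε) (≤-<-trans q Kδ<ε)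
      where
      0<1+K : 0# < 1# + K
      0<1+K = <-≤-trans 0<1 (≤-trans (≈⇒≤ (sym (+-identityʳ 1#))) (+-monoʳ-≤ 1# 0≤K))
      δ : ℝ
      -- The summand `1#` keeps the divisor positive when `K` is 0 and makes K δ strictly smaller
      -- than (1 + K) δ = ε.
      δ = ε / (1# + K)
      0<δ : 0# < δ
      0<δ = *-pos 0<ε (⁻¹-pos 0<1+K)
      Kδ<ε : K * δ < ε
      Kδ<ε = begin-strict
        K * δ            ≈⟨ +-identityˡ _ ⟨
        0# + K * δ       <⟨ +-monoˡ-< (K * δ) 0<δ ⟩
        δ + K * δ        ≈⟨ +-congʳ (*-identityˡ δ) ⟨
        1# * δ + K * δ   ≈⟨ distribʳ δ 1# K ⟨
        (1# + K) * δ     ≈⟨ *-/-cancel ε 0<1+K ⟩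
        ε                ∎

  module OnConnectedGraph {n : ℕ} (G : WeightedGraph n) (d : ℕ) (connected : WeightedGraph.Connected G) where

    open WeightedGraph G
    open OnGraph G d
    open OnConnected G d connected

    weight : Fin (n ℕ.* d) → Fin (n ℕ.* d) → ℝ
    weight r q = w (quotient d r) (quotient d q)

    σ₀-close : ∀ {δ} → 0# ≤ δ → ∀ s τ → Close δ s τ → ∀ x y a b →
               Bounded δ (Signature.σ₀ τ x y a b - Signature.σ₀ s x y a b)
    σ₀-close {δ} 0≤δ s τ close x y a b = by-cases (0# <? w x y)
      where
      by-cases : Dec (Edge x y) → Bounded δ (Signature.σ₀ τ x y a b - Signature.σ₀ s x y a b)
      by-cases (yes e) = bounded-resp-≈
        (sym (+-cong (σ₀-edge τ e a b) (-‿cong (σ₀-edge s e a b))))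
        (let p , q = ∣∣<-elim (close x y e a b) in inj₁ p , inj₁ q)
      by-cases (no ¬e) = bounded-zero 0≤δ (trans
        (+-cong (σ₀-nonedge τ ¬e a b) (-‿cong (σ₀-nonedge s ¬e a b))) (-‿inverseʳ 0#))

    -- The diagonal blocks contain only degrees and cancel; elsewhere the blocks differ by the
    -- weight times the difference of transports.
    𝓛-close : ∀ {δ} → 0# ≤ δ → ∀ s τ → Close δ s τ → ∀ r q →
              Bounded (weight r q * δ) (Signature.𝓛 s r q - Signature.𝓛 τ r q)
    𝓛-close {δ} 0≤δ s τ close r q =
      block-close (quotient d r) (quotient d q) (remainder {n} d r) (remainder {n} d q)
      where
      block : Signature G d → Fin n → Fin n → Matrix d d
      block s x y = if does (x Fin.≟ y) then deg x ·ᴹ 1ᴹ else (- w x y) ·ᴹ Signature.σ₀ s x y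

      block-close : ∀ x y a b → Bounded (w x y * δ) (block s x y a b - block τ x y a b)
      block-close x y a b with does (x Fin.≟ y)
      ... | true  = bounded-zero (*-nonneg (w-nonneg x y) 0≤δ) (-‿inverseʳ _)
      ... | false = bounded-resp-≈
        (solve 3 (λ w p q → w :* (p :- q) := :- w :* q :- :- w :* p) refl
          (w x y) (Signature.σ₀ τ x y a b) (Signature.σ₀ s x y a b))
        (bounded-* (w-nonneg x y) (bounded-nonneg (w-nonneg x y) (≈⇒≤ refl))
          (σ₀-close 0≤δ s τ close x y a b))

    module _ {j : Fin n} where

      C : ℝ
      C = proj₁ (coercive connected j)

      0≤C : 0# ≤ C
      0≤C = proj₁ (proj₂ (coercive connected j))

      -- Testing the equation with `X` itself shows that its energy is its value at `i`. Coercivity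
      -- at `i` bounds this value by `C`, and coercivity elsewhere then bounds every squared entry
      -- by C².
      green-bounded : ∀ {s i c X} → IsGreen s i j c X → ∀ r → Bounded C (X r)
      green-bounded {s} {i} {c} {X} (X≈0 , green) r =
        ≡.subst (λ r → Bounded C (X r)) (Fin.combine-remQuot {n} d r)
          (sq≤sq⇒bounded 0≤C (≤-trans (X²≤ _ _) (*-monoʳ-≤ 0≤C (x²≤Bx⇒x≤B 0≤C (X²≤ i c)))))
        where
        X²≤ : ∀ x a → at X x a * at X x a ≤ C * at X i c
        X²≤ x a = ≤-trans (proj₂ (proj₂ (coercive connected j)) s X X≈0 x a)
          (≈⇒≤ (*-congˡ (green X X≈0)))

      -- The energy form is symmetric, so pairing each Green's function with
      -- the other's equation leaves only the difference of the Laplacians.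
      green-perturbation : ∀ {s τ i c X X′} → IsGreen s i j c X → IsGreen τ i j c X′ →
        at X′ i c - at X i c ≈
        ∑[ r < n ℕ.* d ] (X r * ∑[ q < n ℕ.* d ] ((Signature.𝓛 s r q - Signature.𝓛 τ r q) * X′ q))
      green-perturbation {s} {τ} {i} {c} {X} {X′} (X≈0 , green) (X′≈0 , green′) = begin-equality
        at X′ i c - at X i c
          ≈⟨ +-cong (green X′ X′≈0) (-‿cong (green′ X X≈0)) ⟨
        𝓔 s X′ X - 𝓔 τ X X′
          ≈⟨ +-congʳ (⟨⟩-·-symm (𝓛-symm s) X′ X) ⟩
        𝓔 s X X′ - 𝓔 τ X X′
          ≈⟨ ⟨⟩-distrib-sub X (Signature.𝓛 s · X′) (Signature.𝓛 τ · X′) ⟨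
        ⟨ X , (λ r → (Signature.𝓛 s · X′) r - (Signature.𝓛 τ · X′) r) ⟩
          ≈⟨ ⟨⟩-congˡ X (λ r → trans (sym (sum-distrib-sub {n ℕ.* d} _ _)) (sum-cong-≋ {n ℕ.* d} (λ q →
               solve 3 (λ a b x → a :* x :- b :* x := (a :- b) :* x) refl
                 (Signature.𝓛 s r q) (Signature.𝓛 τ r q) (X′ q)))) ⟩
        ∑[ r < n ℕ.* d ] (X r * ∑[ q < n ℕ.* d ] ((Signature.𝓛 s r q - Signature.𝓛 τ r q) * X′ q)) ∎

      -- In the perturbation identity each Green's function contributes a factor `C` and each entry
      -- of the Laplacian difference a factor weight times δ; `K` collects these products.
      green-lipschitz : ∀ {i c} (X : Signature G d → Fin (n ℕ.* d) → ℝ) →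
                        (∀ s → IsGreen s i j c (X s)) → Lipschitz (λ s → at (X s) i c)
      green-lipschitz {i} {c} X green = K , 0≤K , λ {δ} 0≤δ s τ close →
        bounded-resp-≈ (sym (green-perturbation (green s) (green τ)))
          (bounded-weaken (≈⇒≤ (factor δ))
            (bounded-sum {n ℕ.* d} λ r → bounded-* 0≤C (green-bounded (green s) r)
              (bounded-sum {n ℕ.* d} λ q → bounded-* (*-nonneg (w-nonneg _ _) 0≤δ)
                (𝓛-close 0≤δ s τ close r q) (green-bounded (green τ) q))))
        where
        K : ℝ
        K = ∑[ r < n ℕ.* d ] (C * ∑[ q < n ℕ.* d ] (weight r q * C))

        0≤K : 0# ≤ K
        0≤K = sum-nonneg {n ℕ.* d} λ r → *-nonneg 0≤C
          (sum-nonneg {n ℕ.* d} λ q → *-nonneg (w-nonneg _ _) 0≤C)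

        factor : ∀ δ → ∑[ r < n ℕ.* d ] (C * ∑[ q < n ℕ.* d ] (weight r q * δ * C)) ≈ K * δ
        factor δ = sym (trans (*-distribʳ-sum {n ℕ.* d} _ _) (sum-cong-≋ {n ℕ.* d} λ r →
          trans (*-assoc _ _ _) (*-congˡ (trans (*-distribʳ-sum {n ℕ.* d} _ _) (sum-cong-≋ {n ℕ.* d} λ q →
            solve 3 (λ w C δ → w :* C :* δ := w :* δ :* C) refl (weight r q) C δ)))))

    -- Up to a factor independent of the signature, the trace is a finite sum of diagonal Green's
    -- values, one family grounded at `j` and one, with the nodes exchanged, grounded at `i`.
    resistance-lipschitz : ∀ {i j} → i ≢ j → Lipschitz (λ (s : Signature G d) → Signature.resistance s i j)
    resistance-lipschitz {i} {j} i≢j = lipschitz-* (1# / ((2 ℕ.* d) ×ℝ 1#)) (lipschitz-sum {m = d} λ c →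
      lipschitz-+ (diagonal i≢j c) (diagonal (i≢j ∘ ≡.sym) c))
      where
      diagonal : ∀ {i j} → i ≢ j → ∀ c → Lipschitz (λ (s : Signature G d) →
        (Signature.𝓦 s i j ᵀ ⊗ Signature.𝓛 s ⊗ Signature.𝓦 s i j) c c)
      diagonal i≢j c = lipschitz-resp-≈ (λ s → sym (𝓦𝓛𝓦-diagonal s i≢j c))
        (green-lipschitz (λ s → green s i≢j c) (λ s → green-isGreen s i≢j c))

theorem6p11 : (𝓡 : CompleteOrderedField) → let open Real 𝓡 in
    (n d : ℕ) .{{_ : NonZero d}} (G : WeightedGraph n) → WeightedGraph.Connected G →
    (i j : Fin n) → i ≢ j →
    Continuous (λ (σ : Signature G d) → Signature.resistance σ i j)
theorem6p11 𝓡 n d G connected i j i≢j =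
  lipschitz⇒continuous (OnConnectedGraph.resistance-lipschitz G d connected i≢j)
  where
  open Continuity 𝓡
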